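{- For every integer $n\geq 1$, $$cr(K_n\times P_2)\leq \left\lfloor\frac{n}{2}\right\rfloor\left\lfloor\frac{n-1}{2}\right\rfloor\left\lfloor\frac{n-2}{2}\right\rfloor\left\lfloor\frac{n-3}{2}\right\rfloor .$$
   Context: The crossing number $cr(G)$ of a graph $G$ is the smallest number of pairwise crossings of edges among all drawings of $G$ in the plane. The Kronecker product $G\times H$ of graphs $G$ and $H$ has vertex set $V(G)\times V(H)$ and edge set $\{\{(a,x),(b,y)\} : \{a,b\}\in E(G),\ \{x,y\}\in E(H)\}$. $K_n$ is the complete graph on $n$ vertices and $P_2$ is the path on $2$ vertices (a single edge). -}

module Defs where

open import Algebra.Bundles using (CommutativeRing)
open import Data.Fin.Base using (Fin; toℕ)
open import Data.Nat.Base as ℕ using (ℕ)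
import Data.Nat.Properties as ℕ
open import Data.Product.Base using (∃; ∃-syntax; _×_; _,_; proj₁; swap)
open import Data.Product.Relation.Binary.Pointwise.NonDependent using (×-setoid)
open import Data.Sum.Base as Sum using (_⊎_; inj₁; inj₂)
open import Function.Base using (_∘_)
open import Function.Bundles using (Bijection; _⇔_; mk⇔)
open import Level using (0ℓ)
open import Relation.Binary.Bundles using (Setoid)
open import Relation.Binary.Core using (Rel)
import Relation.Binary.Construct.On as On
import Relation.Binary.Construct.StrictToNonStrict as StrictToNonStrict
open import Relation.Binary.PropositionalEquality as ≡ using (_≡_; _≢_)
open import Relation.Binary.Structures using (IsStrictTotalOrder)
open import Relation.Nullary.Negation using (¬_)
open import Relation.Unary using (Pred)

------------------------------------------------------------------------
-- The real numbers

-- The library has no real numbers.  They are axiomatised as a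
-- Dedekind-complete ordered field, which classically determines them up
-- to isomorphism.

record CompleteOrderedField : Set₁ where
  field
    commutativeRing : CommutativeRing 0ℓ 0ℓ

  open CommutativeRing commutativeRing public

  infix 4 _<_
  field
    _<_                : Rel Carrier 0ℓ
    isStrictTotalOrder : IsStrictTotalOrder _≈_ _<_
    0<1                : 0# < 1#
    +-monoʳ-<          : ∀ z {x y} → x < y → z + x < z + y
    *-pos              : ∀ {x y} → 0# < x → 0# < y → 0# < x * y
    inverse            : ∀ x → ¬ (x ≈ 0#) → ∃[ y ] x * y ≈ 1#

  open StrictToNonStrict _≈_ _<_ public using (_≤_)

  UpperBound : Pred Carrier 0ℓ → Pred Carrier 0ℓ
  UpperBound P b = ∀ x → P x → x ≤ b

  field
    supremum : (P : Pred Carrier 0ℓ) → ∃ P → ∃ (UpperBound P) →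
               ∃[ s ] UpperBound P s × (∀ b → UpperBound P b → s ≤ b)

------------------------------------------------------------------------
-- Graphs

record Graph : Set₁ where
  infix 4 _~_
  field
    V      : Set
    _~_    : Rel V 0ℓ
    ~-sym  : ∀ {u v} → u ~ v → v ~ u
    ~-irr  : ∀ {v} → ¬ (v ~ v)

open Graph using (V)

K : ℕ → Graph
K n = record
  { V     = Fin n
  ; _~_   = _≢_
  ; ~-sym = ≡.≢-sym
  ; ~-irr = λ v≢v → v≢v ≡.refl
  }

P : ℕ → Graph
P m = record
  { V     = Fin m
  ; _~_   = λ i j → ℕ.suc (toℕ i) ≡ toℕ j ⊎ ℕ.suc (toℕ j) ≡ toℕ i
  ; ~-sym = Sum.swap
  ; ~-irr = Sum.[ ℕ.1+n≢n , ℕ.1+n≢n ]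
  }

infixl 7 _×ᴷ_

_×ᴷ_ : Graph → Graph → Graph
G ×ᴷ H = record
  { V     = V G × V H
  ; _~_   = λ (a , x) (b , y) → a G.~ b × x H.~ y
  ; ~-sym = λ (p , q) → G.~-sym p , H.~-sym q
  ; ~-irr = G.~-irr ∘ proj₁
  }
  where
  module G = Graph G
  module H = Graph H

------------------------------------------------------------------------
-- Unordered pairs

unorderedPair : Setoid 0ℓ 0ℓ → Setoid 0ℓ 0ℓ
unorderedPair S = record
  { Carrier       = A × A
  ; _≈_           = λ p q → p ≈ᵒ q ⊎ p ≈ᵒ swap q
  ; isEquivalence = record
    { refl  = inj₁ O.refl
    ; sym   = Sum.map O.sym (swap ∘ O.sym)
    ; trans = λ where
        (inj₁ p) (inj₁ q) → inj₁ (O.trans p q)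
        (inj₁ p) (inj₂ q) → inj₂ (O.trans p q)
        (inj₂ p) (inj₁ q) → inj₂ (O.trans p (swap q))
        (inj₂ p) (inj₂ q) → inj₁ (O.trans p (swap q))
    }
  }
  where
  module O = Setoid (×-setoid S S)
  open Setoid S using () renaming (Carrier to A)
  open O using () renaming (_≈_ to _≈ᵒ_)

-- An edge, without its direction.

edgeSetoid : Graph → Setoid 0ℓ 0ℓ
edgeSetoid G = unorderedPair (≡.setoid (V G))

------------------------------------------------------------------------
-- Drawings in the plane

module _ (ℝ : CompleteOrderedField) where

  open CompleteOrderedField ℝ

  planeSetoid : Setoid 0ℓ 0ℓ
  planeSetoid = ×-setoid setoid setoid

  Point : Set
  Point = Setoid.Carrier planeSetoid

  infix 4 _≈ᴾ_
  _≈ᴾ_ : Rel Point 0ℓ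
  _≈ᴾ_ = Setoid._≈_ planeSetoid

  -- ∣ x - y ∣ < ε

  Within : Carrier → Rel Carrier 0ℓ
  Within ε x y = x < y + ε × y < x + ε

  Withinᴾ : Carrier → Rel Point 0ℓ
  Withinᴾ ε (x , y) (x′ , y′) = Within ε x x′ × Within ε y y′

  ClosedUnit OpenUnit : Pred Carrier 0ℓ
  ClosedUnit t = 0# ≤ t × t ≤ 1#
  OpenUnit   t = 0# < t × t < 1#

  -- Only the restriction of γ to [0,1] matters.  By compactness, a
  -- continuous injective γ is a homeomorphism onto its image.

  record IsArc (γ : Carrier → Point) : Set where
    field
      continuous : ∀ t → ClosedUnit t → ∀ ε → 0# < ε →
                   ∃[ δ ] 0# < δ ×
                     (∀ s → ClosedUnit s → Within δ s t → Withinᴾ ε (γ s) (γ t))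
      injective  : ∀ s t → ClosedUnit s → ClosedUnit t → γ s ≈ᴾ γ t → s ≈ t

  -- arc u v is meaningful only when u ~ v; it is then traversed from u
  -- to v, and arc v u is the same arc traversed backwards.

  record Drawing (G : Graph) : Set where
    open Graph G using (_~_)
    field
      pos           : V G → Point
      arc           : V G → V G → Carrier → Point
      pos-injective : ∀ u v → pos u ≈ᴾ pos v → u ≡ v
      isArc         : ∀ {u v} → u ~ v → IsArc (arc u v)
      arc-source    : ∀ {u v} → u ~ v → arc u v 0# ≈ᴾ pos u
      arc-target    : ∀ {u v} → u ~ v → arc u v 1# ≈ᴾ pos v
      arc-reverse   : ∀ {u v} → u ~ v → ∀ t → ClosedUnit t →
                      arc v u t ≈ᴾ arc u v (1# - t)
      arc-avoids    : ∀ {u v} → u ~ v → ∀ w t → ClosedUnit t →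
                      arc u v t ≈ᴾ pos w → w ≡ u ⊎ w ≡ v

  -- A crossing is a point interior to two distinct edges, together with
  -- that pair of edges: a point interior to several edges counts once
  -- for every pair of them, and a touching point counts as a crossing.
  -- Forbidding touchings and multiple points would not change the
  -- minimum, since they can be perturbed away without gaining crossings.

  module _ {G : Graph} (D : Drawing G) where

    open Graph G using (_~_)
    open Drawing D using (arc)
    open Setoid (edgeSetoid G) using () renaming (_≈_ to _≈ᴱ_)

    record Crossing : Set where
      field
        {u v w z} : V G
        u~v       : u ~ v
        w~z       : w ~ z
        distinct  : ¬ ((u , v) ≈ᴱ (w , z))
        s t       : Carrier
        s∈        : OpenUnit s
        t∈        : OpenUnit t
        meet      : arc u v s ≈ᴾ arc w z t

      place : Point
      place = arc u v s

      edges : (V G × V G) × (V G × V G)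
      edges = (u , v) , (w , z)

    crossingSetoid : Setoid 0ℓ 0ℓ
    crossingSetoid = On.setoid
      (×-setoid planeSetoid (unorderedPair (edgeSetoid G)))
      (λ (c : Crossing) → Crossing.place c , Crossing.edges c)

    HasCrossings : ℕ → Set
    HasCrossings k = Bijection (≡.setoid (Fin k)) crossingSetoid

  ----------------------------------------------------------------------
  -- The crossing number

  IsCrossingNumber : Graph → ℕ → Set
  IsCrossingNumber G c =
    (∃[ D ] HasCrossings {G} D c) ×
    (∀ (D : Drawing G) k → HasCrossings D k → c ℕ.≤ k)

  -- cr G ≤ b.  Constructively a nonempty set of naturals need not have a
  -- least element, so cr is not a function Graph → ℕ; its upper bounds
  -- are expressed by drawings, and cr≤⇔≤ compares them with the minimum.

  cr≤ : Graph → ℕ → Set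
  cr≤ G b = ∃[ D ] ∃[ k ] HasCrossings {G} D k × k ℕ.≤ b

  cr≤⇔≤ : ∀ {G c} → IsCrossingNumber G c → ∀ b → cr≤ G b ⇔ c ℕ.≤ b
  cr≤⇔≤ ((D , D-c) , least) b = mk⇔
    (λ (D′ , k , D′-k , k≤b) → ℕ.≤-trans (least D′ k D′-k) k≤b)
    (λ c≤b → D , _ , D-c , c≤b)

{-# OPTIONS --safe #-}
module Submission where

open import Defs
open import Algebra.Bundles using (CommutativeMonoid; CommutativeRing; RawRing)
import Algebra.Properties.AbelianGroup as AbelianGroupProperties
import Algebra.Properties.CommutativeSemigroup as CommutativeSemigroupProperties
import Algebra.Properties.Ring as RingProperties
import Algebra.Solver.Ring as RingSolver
open import Algebra.Solver.Ring.AlmostCommutativeRing using (fromCommutativeRing; _-Raw-AlmostCommutative⟶_)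
open import Data.Bool.Base using (Bool; true; false; not; _xor_)
open import Data.Bool.Properties using (not-involutive; xor-assoc; xor-identityʳ; xor-same)
open import Data.Empty using (⊥-elim)
open import Data.Fin.Base as Fin using (Fin; toℕ; fromℕ<)
import Data.Fin.Properties as Fin
open import Data.List.Base using (List; []; _∷_; _++_; map; concatMap; mapMaybe; length; lookup; deduplicate)
open import Data.List.Membership.Propositional using (_∈_)
open import Data.List.Membership.Propositional.Properties using (∈-++⁺ˡ; ∈-++⁺ʳ; ∈-map⁺; ∈-concatMap⁺; ∈-lookup)
import Data.List.Membership.Setoid as SetoidMembership
import Data.List.Membership.Setoid.Properties as SetoidMembershipProperties
import Data.List.Properties as List
import Data.List.Relation.Unary.All as All
open import Data.List.Relation.Unary.AllPairs using (AllPairs; []; _∷_)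
open import Data.List.Relation.Unary.Any as Any using (Any; here; there)
import Data.List.Relation.Unary.Any.Properties as Any
open import Data.List.Relation.Unary.Unique.DecSetoid.Properties using (deduplicate-!)
open import Data.Maybe.Base using (Maybe; just; nothing)
import Data.Maybe.Relation.Unary.Any as MaybeAny
open import Data.Nat.Base as ℕ using (ℕ; zero; suc)
open import Data.Nat.DivMod using (m%n<n; m<n⇒m%n≡m)
import Data.Nat.Properties as ℕ
open import Data.Nat.Solver using (module +-*-Solver)
open import Data.Product.Base using (∃-syntax; _×_; _,_; proj₁; proj₂; swap)
open import Data.Product.Properties using (≡-dec)
open import Data.Sum.Base as Sum using (_⊎_; inj₁; inj₂; [_,_]′)
open import Data.Vec.Base using (Vec; []; _∷_)
open import Function.Base using (_∘_)
open import Function.Bundles using (Bijection)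
open import Level using (0ℓ)
open import Relation.Binary.Bundles using (Setoid; DecSetoid)
open import Relation.Binary.Definitions using (Decidable; tri<; tri≈; tri>)
open import Relation.Binary.PropositionalEquality as ≡ using (_≡_; _≢_)
open import Relation.Binary.Structures using (IsStrictTotalOrder)
open import Relation.Nullary using (¬_; Dec; yes; no)
open import Relation.Nullary.Decidable using (_×-dec_; _⊎-dec_; ¬?)

-- Put vᵢ = (1 , i , i²) and let aᵢ = (-1)ⁱ vᵢ and bᵢ = -aᵢ, as points of
-- the sphere of rays from the origin of ℝ³.  Draw the edge aᵢbⱼ as the
-- shortest great arc, and map the sphere to the plane; the third axis
-- is a suitable pole, since no arc meets it.
--
-- Two arcs cross when a positive combination of their ends coincides.
-- Four points of the moment curve have a unique linear dependency, with
-- alternating signs, so no two arcs cross twice, arcs that share an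
-- index do not cross, and four indices p < q < r < s carry a crossing
-- only for the parity patterns p ≡ q, r ≡ s (edges pq and rs), p ≢ r,
-- q ≢ s (edges pr and qs), p ≡ s, q ≡ r (edges ps and qr), each of which
-- accounts for two crossings.  Counting these quadruples gives the bound.

-- The four-term dependency is never written down. A linear functional of ℝ³ restricted to the curve
-- (1 , t , t²) is a polynomial of degree at most 2, and the choices t - p and (t - p)(t - q)
-- annihilate one or two chosen points. Applied to two representatives of one ray, such a functional
-- compares the remaining coefficients, in size or only in sign.
--
-- With the signs (-1)ⁱ, an edge joins equal orientations exactly when the parities of its indices
-- differ. This turns the sign pattern of a crossing into a parity pattern. The antipodal map, which
-- exchanges aᵢ and bᵢ, is behind the factor two.
--
-- A drawing must come with its exact number of crossings, while only an upper bound is claimed. The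
-- exact number is not computed: an explicit formula for the only possible crossing point of two
-- edges makes crossing decidable, all crossings are found in a list of the required length, and
-- removing repetitions by decidable equality leaves a count that is at most this length.

-- Ring identities with integer coefficients.

module IntegerRingSolver (R : CommutativeRing 0ℓ 0ℓ) where

  open CommutativeRing R hiding (zero)
  open import Algebra.Properties.Semiring.Mult.TCOptimised semiring
    using (×-homo-+; ×1-homo-*) renaming (_×_ to _×′_)
  open RingProperties ring using (-0#≈0#; x[y-z]≈xy-xz; [y-z]x≈yx-zx)
  open AbelianGroupProperties +-abelianGroup
    using (⁻¹-anti-homo‿-) renaming (⁻¹-∙-comm to -‿+-comm)
  open CommutativeSemigroupProperties
    (CommutativeMonoid.commutativeSemigroup +-commutativeMonoid)
    using (interchange)
  open import Relation.Binary.Reasoning.Setoid setoid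

  -- The coefficient (m , n) stands for the integer m - n.  The solver
  -- compares normal forms syntactically, so it has to be kept reduced.
  reduce : ℕ × ℕ → ℕ × ℕ
  reduce (suc a , suc b) = reduce (a , b)
  reduce p               = p

  Difference : RawRing 0ℓ 0ℓ
  Difference = record
    { Carrier = ℕ × ℕ
    ; _≈_     = _≡_
    ; _+_     = λ (a , b) (c , d) → reduce (a ℕ.+ c , b ℕ.+ d)
    ; _*_     = λ (a , b) (c , d) → reduce (a ℕ.* c ℕ.+ b ℕ.* d , a ℕ.* d ℕ.+ b ℕ.* c)
    ; -_      = swap
    ; 0#      = 0 , 0
    ; 1#      = 1 , 0
    }

  -- The separate clause for `zero` makes (0 , 0) and (1 , 0) denote `0#` and `1#` definitionally,
  -- so that `:0` and `:1` match the constants in goals.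
  ⟦_⟧ : ℕ × ℕ → Carrier
  ⟦ a , zero ⟧      = a ×′ 1#
  ⟦ a , b@(suc _) ⟧ = a ×′ 1# - b ×′ 1#

  ⟦⟧≈- : ∀ a b → ⟦ a , b ⟧ ≈ a ×′ 1# - b ×′ 1#
  ⟦⟧≈- a zero    = sym (trans (+-congˡ -0#≈0#) (+-identityʳ _))
  ⟦⟧≈- a (suc b) = refl

  ⟦reduce⟧ : ∀ a b → ⟦ reduce (a , b) ⟧ ≈ a ×′ 1# - b ×′ 1#
  ⟦reduce⟧ zero    b       = ⟦⟧≈- zero b
  ⟦reduce⟧ (suc a) zero    = ⟦⟧≈- (suc a) zero
  ⟦reduce⟧ (suc a) (suc b) = begin
    ⟦ reduce (a , b) ⟧                    ≈⟨ ⟦reduce⟧ a b ⟩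
    a ×′ 1# - b ×′ 1#                     ≈⟨ +-identityˡ _ ⟨
    0# + (a ×′ 1# - b ×′ 1#)              ≈⟨ +-congʳ (-‿inverseʳ 1#) ⟨
    (1# - 1#) + (a ×′ 1# - b ×′ 1#)       ≈⟨ interchange _ _ _ _ ⟩
    (1# + a ×′ 1#) + (- 1# - b ×′ 1#)     ≈⟨ +-congˡ (-‿+-comm _ _) ⟩
    (1# + a ×′ 1#) - (1# + b ×′ 1#)       ≈⟨ +-cong (×-homo-+ 1# 1 a) (-‿cong (×-homo-+ 1# 1 b)) ⟨
    suc a ×′ 1# - suc b ×′ 1#             ∎

  +-homo : ∀ p q → ⟦ Difference .RawRing._+_ p q ⟧ ≈ ⟦ p ⟧ + ⟦ q ⟧
  +-homo (a , b) (c , d) = begin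
    ⟦ reduce (a ℕ.+ c , b ℕ.+ d) ⟧                     ≈⟨ ⟦reduce⟧ (a ℕ.+ c) (b ℕ.+ d) ⟩
    (a ℕ.+ c) ×′ 1# - (b ℕ.+ d) ×′ 1#                   ≈⟨ +-cong (×-homo-+ 1# a c) (-‿cong (×-homo-+ 1# b d)) ⟩
    (a ×′ 1# + c ×′ 1#) - (b ×′ 1# + d ×′ 1#)           ≈⟨ +-congˡ (-‿+-comm _ _) ⟨
    (a ×′ 1# + c ×′ 1#) + (- (b ×′ 1#) - d ×′ 1#)       ≈⟨ interchange _ _ _ _ ⟩
    (a ×′ 1# - b ×′ 1#) + (c ×′ 1# - d ×′ 1#)           ≈⟨ +-cong (⟦⟧≈- a b) (⟦⟧≈- c d) ⟨
    ⟦ a , b ⟧ + ⟦ c , d ⟧                              ∎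

  *-homo : ∀ p q → ⟦ Difference .RawRing._*_ p q ⟧ ≈ ⟦ p ⟧ * ⟦ q ⟧
  *-homo (a , b) (c , d) = begin
    ⟦ reduce (a ℕ.* c ℕ.+ b ℕ.* d , a ℕ.* d ℕ.+ b ℕ.* c) ⟧
      ≈⟨ ⟦reduce⟧ (a ℕ.* c ℕ.+ b ℕ.* d) (a ℕ.* d ℕ.+ b ℕ.* c) ⟩
    (a ℕ.* c ℕ.+ b ℕ.* d) ×′ 1# - (a ℕ.* d ℕ.+ b ℕ.* c) ×′ 1#
      ≈⟨ +-cong (sum a c b d) (-‿cong (sum a d b c)) ⟩
    (A * C + B * D) - (A * D + B * C)              ≈⟨ +-congˡ (-‿+-comm _ _) ⟨
    (A * C + B * D) + (- (A * D) - B * C)          ≈⟨ +-congˡ (+-comm _ _) ⟩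
    (A * C + B * D) + (- (B * C) - A * D)          ≈⟨ interchange _ _ _ _ ⟩
    (A * C - B * C) + (B * D - A * D)              ≈⟨ +-cong ([y-z]x≈yx-zx C A B) (⁻¹-anti-homo‿- (A * D) (B * D)) ⟨
    (A - B) * C - (A * D - B * D)                  ≈⟨ +-congˡ (-‿cong ([y-z]x≈yx-zx D A B)) ⟨
    (A - B) * C - (A - B) * D                      ≈⟨ x[y-z]≈xy-xz (A - B) C D ⟨
    (A - B) * (C - D)                              ≈⟨ *-cong (⟦⟧≈- a b) (⟦⟧≈- c d) ⟨
    ⟦ a , b ⟧ * ⟦ c , d ⟧                          ∎
    where
    A B C D : Carrier
    A = a ×′ 1#
    B = b ×′ 1#
    C = c ×′ 1#
    D = d ×′ 1#
    sum : ∀ m n k l → (m ℕ.* n ℕ.+ k ℕ.* l) ×′ 1# ≈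
          m ×′ 1# * n ×′ 1# + k ×′ 1# * l ×′ 1#
    sum m n k l = trans (×-homo-+ 1# (m ℕ.* n) (k ℕ.* l)) (+-cong (×1-homo-* m n) (×1-homo-* k l))

  -‿homo : ∀ p → ⟦ swap p ⟧ ≈ - ⟦ p ⟧
  -‿homo (a , b) = begin
    ⟦ b , a ⟧              ≈⟨ ⟦⟧≈- b a ⟩
    b ×′ 1# - a ×′ 1#      ≈⟨ ⁻¹-anti-homo‿- _ _ ⟨
    - (a ×′ 1# - b ×′ 1#)  ≈⟨ -‿cong (⟦⟧≈- a b) ⟨
    - ⟦ a , b ⟧            ∎

  morphism : Difference -Raw-AlmostCommutative⟶ fromCommutativeRing R
  morphism = record
    { ⟦_⟧    = ⟦_⟧
    ; +-homo = +-homo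
    ; *-homo = *-homo
    ; -‿homo = -‿homo
    ; 0-homo = refl
    ; 1-homo = refl
    }

  ⟦⟧-cong? : ∀ p q → Maybe (⟦ p ⟧ ≈ ⟦ q ⟧)
  ⟦⟧-cong? p q with ≡-dec ℕ._≟_ ℕ._≟_ p q
  ... | yes ≡.refl = just refl
  ... | no  _      = nothing

  open RingSolver Difference (fromCommutativeRing R) morphism ⟦⟧-cong? public
    using (Polynomial; solve; con; _:=_; _:+_; _:*_; _:-_; :-_)

  :0 :1 : ∀ {n} → Polynomial n
  :0 = con (0 , 0)
  :1 = con (1 , 0)

-- Arithmetic, inequalities and continuity in an ordered field.

module OrderedField (ℝ : CompleteOrderedField) where

  open CompleteOrderedField ℝ public hiding (zero)
  open IntegerRingSolver commutativeRing public
    using (solve; con; _:=_; _:+_; _:*_; _:-_; :-_; :0; :1)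
  open IsStrictTotalOrder isStrictTotalOrder public
    using (compare; _≟_; _<?_; <-resp-≈)
    renaming (irrefl to <-irrefl; trans to <-trans)

  Pos : Carrier → Set
  Pos x = 0# < x

  Pos-resp : ∀ {x y} → x ≈ y → Pos x → Pos y
  Pos-resp = proj₁ <-resp-≈

  <-respˡ : ∀ {x y z} → x ≈ y → x < z → y < z
  <-respˡ = proj₂ <-resp-≈

  <-respʳ : ∀ {x y z} → x ≈ y → z < x → z < y
  <-respʳ = proj₁ <-resp-≈

  <⇒Pos : ∀ {x y} → x < y → Pos (y - x)
  <⇒Pos {x} {y} x<y = Pos-resp (+-comm (- x) y) (<-respˡ (-‿inverseˡ x) (+-monoʳ-< (- x) x<y))

  Pos⇒< : ∀ {x y} → Pos (y - x) → x < y
  Pos⇒< {x} {y} p = <-respˡ (+-identityʳ x)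
    (<-respʳ (solve 2 (λ x y → x :+ (y :- x) := y) refl x y) (+-monoʳ-< x p))

  Pos-+ : ∀ {x y} → Pos x → Pos y → Pos (x + y)
  Pos-+ {x} p q = <-trans p (<-respˡ (+-identityʳ x) (+-monoʳ-< x q))

  Pos-neg : ∀ {x} → x < 0# → Pos (- x)
  Pos-neg x<0 = Pos-resp (+-identityˡ _) (<⇒Pos x<0)

  ¬Pos-0 : ∀ {x} → Pos x → ¬ x ≈ 0#
  ¬Pos-0 p x≈0 = <-irrefl (sym x≈0) p

  ¬Pos-neg : ∀ {x} → Pos x → ¬ Pos (- x)
  ¬Pos-neg {x} p q = <-irrefl (sym (-‿inverseʳ x)) (Pos-+ p q)

  data Sign (x : Carrier) : Set where
    pos  : Pos x → Sign x
    nul  : x ≈ 0# → Sign x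
    neg  : Pos (- x) → Sign x

  sign : ∀ x → Sign x
  sign x with compare x 0#
  ... | tri< x<0 _ _ = neg (Pos-neg x<0)
  ... | tri≈ _ x≈0 _ = nul x≈0
  ... | tri> _ _ 0<x = pos 0<x

  Pos-cancelˡ : ∀ {x y} → Pos x → Pos (x * y) → Pos y
  Pos-cancelˡ {x} {y} p q with sign y
  ... | pos r  = r
  ... | nul r = ⊥-elim (¬Pos-0 q (trans (*-congˡ r) (zeroʳ x)))
  ... | neg r  = ⊥-elim (¬Pos-neg q
    (Pos-resp (solve 2 (λ x y → x :* (:- y) := :- (x :* y)) refl x y) (*-pos p r)))

  -- The value `0#` at zero makes `inv` total and still a congruence, so that `project` is defined
  -- on all of space and `project-cong` needs no side condition.
  inv : Carrier → Carrier
  inv x with x ≟ 0#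
  ... | yes _   = 0#
  ... | no  x≉0 = proj₁ (inverse x x≉0)

  inv-inverse : ∀ {x} → ¬ x ≈ 0# → x * inv x ≈ 1#
  inv-inverse {x} x≉0 with x ≟ 0#
  ... | yes x≈0 = ⊥-elim (x≉0 x≈0)
  ... | no  p   = proj₂ (inverse x p)

  *-cancelʳ : ∀ {x y z} → ¬ z ≈ 0# → x * z ≈ y * z → x ≈ y
  *-cancelʳ {x} {y} {z} z≉0 eq = trans (expand x) (trans (*-congʳ eq) (sym (expand y)))
    where
    expand : ∀ a → a ≈ a * z * inv z
    expand a = sym (trans (*-assoc a z _) (trans (*-congˡ (inv-inverse z≉0)) (*-identityʳ a)))

  inv-cong : ∀ {x y} → x ≈ y → inv x ≈ inv y
  inv-cong {x} {y} x≈y with y ≟ 0# in eq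
  inv-cong {x} {y} x≈y | yes y≈0 with x ≟ 0#
  ... | yes _   = refl
  ... | no  x≉0 = ⊥-elim (x≉0 (trans x≈y y≈0))
  inv-cong {x} {y} x≈y | no y≉0 = *-cancelʳ x≉0 (trans (*-comm _ x)
    (trans (inv-inverse x≉0) (trans (sym (proj₂ (inverse y y≉0)))
      (trans (*-congʳ (sym x≈y)) (*-comm x _)))))
    where
    x≉0 : ¬ x ≈ 0#
    x≉0 x≈0 = y≉0 (trans (sym x≈y) x≈0)

  inv-pos : ∀ {x} → Pos x → Pos (inv x)
  inv-pos p = Pos-cancelˡ p (Pos-resp (sym (inv-inverse (¬Pos-0 p))) 0<1)

  *-nonzero : ∀ {x y} → ¬ x ≈ 0# → ¬ y ≈ 0# → ¬ x * y ≈ 0#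
  *-nonzero x≉0 y≉0 xy≈0 = x≉0 (*-cancelʳ y≉0 (trans xy≈0 (sym (zeroˡ _))))

  half : Carrier
  half = inv (1# + 1#)

  half-pos : Pos half
  half-pos = inv-pos (Pos-+ 0<1 0<1)

  half+half : half + half ≈ 1#
  half+half = trans (solve 1 (λ h → h :+ h := (:1 :+ :1) :* h) refl half)
    (inv-inverse (¬Pos-0 (Pos-+ 0<1 0<1)))

  -- The disjunctions spell z ≤ x and z ≤ y in the form that `Small-weaken` takes.
  lower : ∀ {x y} → Pos x → Pos y →
          ∃[ z ] Pos z × (z ≈ x ⊎ Pos (x - z)) × (z ≈ y ⊎ Pos (y - z))
  lower {x} {y} p q with compare x y
  ... | tri< x<y _ _ = x , p , inj₁ refl , inj₂ (<⇒Pos x<y)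
  ... | tri≈ _ x≈y _ = x , p , inj₁ refl , inj₁ x≈y
  ... | tri> _ _ y<x = y , q , inj₂ (<⇒Pos y<x) , inj₁ refl

  -- Absolute values

  ∣_∣ : Carrier → Carrier
  ∣ x ∣ with sign x
  ... | pos _  = x
  ... | nul _ = 0#
  ... | neg _  = - x

  ∣∣-pos : ∀ {x} → Pos x → ∣ x ∣ ≈ x
  ∣∣-pos {x} p with sign x
  ... | pos _  = refl
  ... | nul e = ⊥-elim (¬Pos-0 p e)
  ... | neg q  = ⊥-elim (¬Pos-neg p q)

  ∣∣-zero : ∀ {x} → x ≈ 0# → ∣ x ∣ ≈ 0#
  ∣∣-zero {x} e with sign x
  ... | pos p  = ⊥-elim (¬Pos-0 p e)
  ... | nul _ = refl
  ... | neg q  = trans (-‿cong e) (solve 0 (:- :0 := :0) refl)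

  ∣∣-neg : ∀ {x} → Pos (- x) → ∣ x ∣ ≈ - x
  ∣∣-neg {x} q with sign x
  ... | pos p  = ⊥-elim (¬Pos-neg p q)
  ... | nul e = ⊥-elim (¬Pos-0 q (trans (-‿cong e) (solve 0 (:- :0 := :0) refl)))
  ... | neg _  = refl

  ∣∣-cong : ∀ {x y} → x ≈ y → ∣ x ∣ ≈ ∣ y ∣
  ∣∣-cong {x} {y} x≈y with sign y
  ... | pos p  = trans (∣∣-pos (Pos-resp (sym x≈y) p)) x≈y
  ... | nul e = ∣∣-zero (trans x≈y e)
  ... | neg q  = trans (∣∣-neg (Pos-resp (-‿cong (sym x≈y)) q)) (-‿cong x≈y)

  ∣∣-scale : ∀ {c} x → Pos c → ∣ x * c ∣ ≈ ∣ x ∣ * c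
  ∣∣-scale {c} x 0<c with sign x
  ... | pos p  = ∣∣-pos (*-pos p 0<c)
  ... | nul e = trans (∣∣-zero (trans (*-congʳ e) (zeroˡ c))) (sym (zeroˡ c))
  ... | neg q  = trans (∣∣-neg (Pos-resp eq (*-pos q 0<c))) (sym eq)
    where
    eq : - x * c ≈ - (x * c)
    eq = solve 2 (λ x c → (:- x) :* c := :- (x :* c)) refl x c

  Pos-+∣∣ : ∀ {x} y → Pos x → Pos (x + ∣ y ∣)
  Pos-+∣∣ y p with sign y
  ... | pos q  = Pos-+ p q
  ... | nul _ = Pos-resp (sym (+-identityʳ _)) p
  ... | neg q  = Pos-+ p q

  Pos-∣∣+ : ∀ {x} y → Pos x → Pos (∣ y ∣ + x)
  Pos-∣∣+ y p = Pos-resp (+-comm _ _) (Pos-+∣∣ y p)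

  Pos-∣∣ : ∀ {x} → ¬ x ≈ 0# → Pos ∣ x ∣
  Pos-∣∣ {x} x≉0 with sign x
  ... | pos p  = p
  ... | nul e = ⊥-elim (x≉0 e)
  ... | neg q  = q

  -- Holds because ∣ y ∣ + y is never negative; it makes `factor` positive.
  ∣∣-lower : ∀ {x} y → Pos x → Pos ((x + ∣ y ∣) + y)
  ∣∣-lower {x} y p with sign y
  ... | pos q  = Pos-+ (Pos-+ p q) q
  ... | nul e = Pos-resp (sym (trans (+-cong (+-identityʳ x) e) (+-identityʳ x))) p
  ... | neg _  = Pos-resp (solve 2 (λ x y → x := (x :+ (:- y)) :+ y) refl x y) p

  -- This is ∣ x ∣ < ε as two positivity statements, which add and multiply without a case
  -- distinction on the sign of x.
  Small : Carrier → Carrier → Set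
  Small ε x = Pos (ε - x) × Pos (ε + x)

  -- The reverse triangle inequality. Equal signs preserve the difference up to sign; for opposite
  -- signs each new slack exceeds an old one by twice an absolute value.
  Small-∣∣ : ∀ {ε} x y → Small ε (x - y) → Small ε (∣ x ∣ - ∣ y ∣)
  Small-∣∣ {ε} x y (p , q) with sign x | sign y
  ... | pos a  | pos b  = p , q
  ... | pos a  | nul b = Pos-resp (+-congˡ (-‿cong (+-congˡ (-‿cong b)))) p , Pos-resp (+-congˡ (+-congˡ (-‿cong b))) q
  ... | nul a | pos b  = Pos-resp (+-congˡ (-‿cong (+-congʳ a))) p , Pos-resp (+-congˡ (+-congʳ a)) q
  ... | nul a | nul b = Pos-resp (+-congˡ (-‿cong (+-cong a (-‿cong b)))) p , Pos-resp (+-congˡ (+-cong a (-‿cong b))) q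
  ... | neg a  | neg b  = Pos-resp (solve 3 (λ e x y → e :+ (x :- y) := e :- ((:- x) :- (:- y))) refl ε x y) q ,
                          Pos-resp (solve 3 (λ e x y → e :- (x :- y) := e :+ ((:- x) :- (:- y))) refl ε x y) p
  ... | neg a  | nul b = Pos-resp (trans (+-congˡ (+-congˡ (-‿cong b))) (solve 2 (λ e x → e :+ (x :- :0) := e :- ((:- x) :- :0)) refl ε x)) q ,
                          Pos-resp (trans (+-congˡ (-‿cong (+-congˡ (-‿cong b)))) (solve 2 (λ e x → e :- (x :- :0) := e :+ ((:- x) :- :0)) refl ε x)) p
  ... | nul a | neg b  = Pos-resp (trans (+-congˡ (+-congʳ a)) (solve 2 (λ e y → e :+ (:0 :- y) := e :- (:0 :- (:- y))) refl ε y)) q ,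
                          Pos-resp (trans (+-congˡ (-‿cong (+-congʳ a))) (solve 2 (λ e y → e :- (:0 :- y) := e :+ (:0 :- (:- y))) refl ε y)) p
  ... | pos a  | neg b  = Pos-resp (solve 3 (λ e x y → (e :- (x :- y)) :+ ((:- y) :+ (:- y)) := e :- (x :- (:- y))) refl ε x y) (Pos-+ p (Pos-+ b b)) ,
                          Pos-resp (solve 3 (λ e x y → (e :- (x :- y)) :+ (x :+ x) := e :+ (x :- (:- y))) refl ε x y) (Pos-+ p (Pos-+ a a))
  ... | neg a  | pos b  = Pos-resp (solve 3 (λ e x y → (e :+ (x :- y)) :+ (y :+ y) := e :- ((:- x) :- y)) refl ε x y) (Pos-+ q (Pos-+ b b)) ,
                          Pos-resp (solve 3 (λ e x y → (e :+ (x :- y)) :+ ((:- x) :+ (:- x)) := e :+ ((:- x) :- y)) refl ε x y) (Pos-+ q (Pos-+ a a))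

  Small-resp : ∀ {ε δ x y} → ε ≈ δ → x ≈ y → Small ε x → Small δ y
  Small-resp e f (p , q) = Pos-resp (+-cong e (-‿cong f)) p , Pos-resp (+-cong e f) q

  Small-weaken : ∀ {ε δ x} → δ ≈ ε ⊎ Pos (ε - δ) → Small δ x → Small ε x
  Small-weaken (inj₁ e) s = Small-resp e refl s
  Small-weaken {ε} {δ} {x} (inj₂ r) (p , q) =
    Pos-resp (solve 3 (λ e d x → (e :- d) :+ (d :- x) := e :- x) refl ε δ x) (Pos-+ r p) ,
    Pos-resp (solve 3 (λ e d x → (e :- d) :+ (d :+ x) := e :+ x) refl ε δ x) (Pos-+ r q)

  Small-+ : ∀ {ε δ x y} → Small ε x → Small δ y → Small (ε + δ) (x + y)
  Small-+ {ε} {δ} {x} {y} (p , q) (r , s) =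
    Pos-resp (solve 4 (λ e d x y → (e :- x) :+ (d :- y) := (e :+ d) :- (x :+ y)) refl ε δ x y) (Pos-+ p r) ,
    Pos-resp (solve 4 (λ e d x y → (e :+ x) :+ (d :+ y) := (e :+ d) :+ (x :+ y)) refl ε δ x y) (Pos-+ q s)

  Pos-halve : ∀ {x} → Pos (x + x) → Pos x
  Pos-halve {x} p = Pos-cancelˡ (Pos-+ 0<1 0<1)
    (Pos-resp (solve 1 (λ x → x :+ x := (:1 :+ :1) :* x) refl x) p)

  -- Twice the slack is a sum of two products of positive numbers: 2(εδ - xy) = (ε - x)(δ + y) + (ε
  -- + x)(δ - y), and likewise for εδ + xy.
  Small-* : ∀ {ε δ x y} → Small ε x → Small δ y → Small (ε * δ) (x * y)
  Small-* {ε} {δ} {x} {y} (p , q) (r , s) =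
    Pos-halve (Pos-resp (solve 4 (λ e d x y →
      (e :- x) :* (d :+ y) :+ (e :+ x) :* (d :- y) := (e :* d :- x :* y) :+ (e :* d :- x :* y))
      refl ε δ x y) (Pos-+ (*-pos p s) (*-pos q r))) ,
    Pos-halve (Pos-resp (solve 4 (λ e d x y →
      (e :- x) :* (d :- y) :+ (e :+ x) :* (d :+ y) := (e :* d :+ x :* y) :+ (e :* d :+ x :* y))
      refl ε δ x y) (Pos-+ (*-pos p r) (*-pos q s)))

  Small-bound : ∀ x → ∃[ K ] Pos K × Small K x
  Small-bound x with sign x
  ... | pos p  = 1# + x , Pos-+ 0<1 p ,
                 Pos-resp (solve 1 (λ x → :1 := (:1 :+ x) :- x) refl x) 0<1 ,
                 Pos-+ (Pos-+ 0<1 p) p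
  ... | nul e = 1# , 0<1 , Small-resp refl (sym e)
                 (Pos-resp (solve 0 (:1 := :1 :- :0) refl) 0<1 , Pos-resp (solve 0 (:1 := :1 :+ :0) refl) 0<1)
  ... | neg q  = 1# - x , Pos-+ 0<1 q , Pos-+ (Pos-+ 0<1 q) q ,
                 Pos-resp (solve 1 (λ x → :1 := (:1 :- x) :+ x) refl x) 0<1

  -- Continuity

  -- Here s ranges over the whole line, not just [0,1]: the curves extend to all parameters without
  -- meeting the third axis.
  Continuous-at : Carrier → (Carrier → Carrier) → Set
  Continuous-at t f = ∀ ε → Pos ε → ∃[ δ ] Pos δ × (∀ s → Small δ (s - t) → Small ε (f s - f t))

  module _ {t : Carrier} where

    private
      Cont = Continuous-at t

    const-continuous : ∀ c → Cont (λ _ → c)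
    const-continuous c ε p = ε , p , λ _ _ →
      Pos-resp (solve 2 (λ e c → e := e :- (c :- c)) refl ε c) p ,
      Pos-resp (solve 2 (λ e c → e := e :+ (c :- c)) refl ε c) p

    id-continuous : Cont (λ s → s)
    id-continuous ε p = ε , p , λ _ small → small

    jointly : ∀ {f g} → Cont f → Cont g → ∀ ε → Pos ε →
              ∃[ δ ] Pos δ × (∀ s → Small δ (s - t) → Small ε (f s - f t) × Small ε (g s - g t))
    jointly cf cg ε p with cf ε p | cg ε p
    ... | δ₁ , p₁ , h₁ | δ₂ , p₂ , h₂ with lower p₁ p₂
    ... | δ , q , l₁ , l₂ = δ , q , λ s small →
      h₁ s (Small-weaken l₁ small) , h₂ s (Small-weaken l₂ small)

    +-continuous : ∀ {f g} → Cont f → Cont g → Cont (λ s → f s + g s)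
    +-continuous {f} {g} cf cg ε p with jointly cf cg (ε * half) (*-pos p half-pos)
    ... | δ , q , h = δ , q , λ s small → let a , b = h s small in
      Small-resp
        (trans (sym (distribˡ ε half half)) (trans (*-congˡ half+half) (*-identityʳ ε)))
        (solve 4 (λ a b c d → (a :- b) :+ (c :- d) := (a :+ c) :- (b :+ d)) refl (f s) (f t) (g s) (g t))
        (Small-+ a b)

    -- Write the difference of the products as (a - b)(c - d) + b(c - d) + d(a - b) with b = f t and
    -- d = g t, bounded by K and L. For η the lesser of 1 and ε / (1 + K + L), the resulting bound
    -- η(η + K + L) is at most ε.
    *-continuous : ∀ {f g} → Cont f → Cont g → Cont (λ s → f s * g s)
    *-continuous {f} {g} cf cg ε p
      with Small-bound (f t) | Small-bound (g t)
    ... | K , K>0 , fK | L , L>0 , gL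
      with lower 0<1 (*-pos p (inv-pos M>0))
      where
      M>0 : Pos (1# + (K + L))
      M>0 = Pos-+ 0<1 (Pos-+ K>0 L>0)
    ... | η , η>0 , η≤1 , η≤ε/M with jointly cf cg η η>0
    ... | δ , q , h = δ , q , λ s small → let a , b = h s small in
      Small-weaken bound (Small-resp
        (solve 3 (λ h K L → h :* h :+ (K :* h :+ L :* h) := h :* (h :+ (K :+ L))) refl η K L)
        (solve 4 (λ a b c d → (a :- b) :* (c :- d) :+ (b :* (c :- d) :+ d :* (a :- b)) := a :* c :- b :* d)
          refl (f s) (f t) (g s) (g t))
        (Small-+ (Small-* a b) (Small-+ (Small-* fK b) (Small-* gL a))))
      where
      M : Carrier
      M = 1# + (K + L)
      M>0 : Pos M
      M>0 = Pos-+ 0<1 (Pos-+ K>0 L>0)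
      ε/M*M : ε * inv M * M ≈ ε
      ε/M*M = trans (*-assoc ε _ M) (trans (*-congˡ (trans (*-comm _ M) (inv-inverse (¬Pos-0 M>0)))) (*-identityʳ ε))
      η*M : η * M ≈ ε ⊎ Pos (ε - η * M)
      η*M = [ (λ e → inj₁ (trans (*-congʳ e) ε/M*M)) , (λ r → inj₂ (Pos-resp (trans (solve 3 (λ x e m → (x :- e) :* m := x :* m :- e :* m) refl (ε * inv M) η M) (+-congʳ ε/M*M)) (*-pos r M>0))) ]′ η≤ε/M
      weaken : η ≈ 1# ⊎ Pos (1# - η) → η * M ≈ ε ⊎ Pos (ε - η * M) →
               η * (η + (K + L)) ≈ ε ⊎ Pos (ε - η * (η + (K + L)))
      weaken (inj₁ e) (inj₁ e′) = inj₁ (trans (*-congˡ (+-congʳ e)) e′)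
      weaken (inj₁ e) (inj₂ r) = inj₂ (Pos-resp (+-congˡ (-‿cong (*-congˡ (+-congʳ (sym e))))) r)
      weaken (inj₂ r) (inj₁ e) = inj₂ (Pos-resp (trans (solve 3 (λ h K L → h :* (:1 :- h) := h :* (:1 :+ (K :+ L)) :- h :* (h :+ (K :+ L))) refl η K L) (+-congʳ e)) (*-pos η>0 r))
      weaken (inj₂ r) (inj₂ r′) = inj₂ (Pos-resp (solve 4 (λ e h K L → (e :- h :* (:1 :+ (K :+ L))) :+ h :* (:1 :- h) := e :- h :* (h :+ (K :+ L))) refl ε η K L) (Pos-+ r′ (*-pos η>0 r)))

      bound : η * (η + (K + L)) ≈ ε ⊎ Pos (ε - η * (η + (K + L)))
      bound = weaken η≤1 η*M

    ∣∣-continuous : ∀ {f} → Cont f → Cont (λ s → ∣ f s ∣)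
    ∣∣-continuous {f} cf ε p with cf ε p
    ... | δ , q , h = δ , q , λ s small → Small-∣∣ (f s) (f t) (h s small)

    -- With a = f t and b = f s, a distance below a/2 forces b > a/2, and then ∣ b - a ∣ < ε(a/2)a
    -- gives ∣ 1/b - 1/a ∣ = ∣ b - a ∣ / (ba) < ε. This is why η is the lesser of a/2 and ε(a/2)a.
    inv-continuous : ∀ {f} → Pos (f t) → Cont f → Cont (λ s → inv (f s))
    inv-continuous {f} a>0 cf ε p
      with lower (*-pos a>0 half-pos) (*-pos p (*-pos (*-pos a>0 half-pos) a>0))
    ... | η , η>0 , η≤a/2 , η≤ with cf η η>0
    ... | δ , q , h = δ , q , λ s small → close s (h s small)
      where
      a = f t
      a/2 = a * half
      a/2+a/2 : a/2 + a/2 ≈ a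
      a/2+a/2 = trans (sym (distribˡ a half half)) (trans (*-congˡ half+half) (*-identityʳ a))
      close : ∀ s → Small η (f s - a) → Small ε (inv (f s) - inv a)
      close s small = Small-resp
        (trans (solve 5 (λ e b a j i → e :* (b :* a) :* (j :* i) := e :* ((b :* j) :* (a :* i))) refl ε b a j i)
          (trans (*-congˡ (trans (*-cong bj ai) (*-identityˡ 1#))) (*-identityʳ ε)))
        (trans (solve 4 (λ b a j i → (a :- b) :* (j :* i) := (a :* i) :* j :- (b :* j) :* i) refl b a j i)
          (+-cong (trans (*-congʳ ai) (*-identityˡ j)) (-‿cong (trans (*-congʳ bj) (*-identityˡ i)))))
        scaled
        where
        b = f s
        i = inv a
        j = inv b
        near : Small a/2 (b - a)
        near = Small-weaken η≤a/2 small
        b>a/2 : Pos (b - a/2)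
        b>a/2 = Pos-resp (trans (solve 3 (λ h b a → h :+ (b :- a) := b :- (a :- h)) refl a/2 b a)
          (+-congˡ (-‿cong (trans (+-congʳ (sym a/2+a/2)) (solve 1 (λ h → (h :+ h) :- h := h) refl a/2))))) (proj₂ near)
        b>0 : Pos b
        b>0 = Pos-resp (solve 2 (λ b h → (b :- h) :+ h := b) refl b a/2) (Pos-+ b>a/2 (*-pos a>0 half-pos))
        ai : a * i ≈ 1#
        ai = inv-inverse (¬Pos-0 a>0)
        bj : b * j ≈ 1#
        bj = inv-inverse (¬Pos-0 b>0)
        gap : Pos (ε * (b * a) - ε * (a/2 * a))
        gap = Pos-resp (solve 4 (λ e b a h → e :* ((b :- h) :* a) := e :* (b :* a) :- e :* (h :* a)) refl ε b a a/2)
          (*-pos p (*-pos b>a/2 a>0))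
        raw : Small (ε * (b * a)) (b - a)
        raw = Small-weaken (inj₂ gap) (Small-weaken η≤ small)
        scaled : Small (ε * (b * a) * (j * i)) ((a - b) * (j * i))
        scaled =
          Pos-resp (solve 5 (λ e b a j i → (e :* (b :* a) :+ (b :- a)) :* (j :* i) := e :* (b :* a) :* (j :* i) :- (a :- b) :* (j :* i)) refl ε b a j i)
            (*-pos (proj₂ raw) ji>0) ,
          Pos-resp (solve 5 (λ e b a j i → (e :* (b :* a) :- (b :- a)) :* (j :* i) := e :* (b :* a) :* (j :* i) :+ (a :- b) :* (j :* i)) refl ε b a j i)
            (*-pos (proj₁ raw) ji>0)
          where
          ji>0 : Pos (j * i)
          ji>0 = *-pos (inv-pos b>0) (inv-pos a>0)

-- From rays in space to points of the plane.

module CentralProjection (ℝ : CompleteOrderedField) where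

  open OrderedField ℝ
  open import Relation.Binary.Reasoning.Setoid setoid

  Space : Set
  Space = Carrier × Carrier × Carrier

  -- Lengths in the ℓ¹ sense avoid square roots. Off the third axis ∣ z ∣ < norm, so `factor` times
  -- `radius`, which is 2 + z / norm, lies strictly between 1 and 3.
  radius norm factor : Space → Carrier
  radius (x , y , _)     = ∣ x ∣ + ∣ y ∣
  norm p@(_ , _ , z)     = radius p + ∣ z ∣
  factor p@(_ , _ , z)   = (norm p + (norm p + z)) * inv (radius p * norm p)

  abstract

    -- Away from the third axis, this identifies the open rays from the
    -- origin with points of the punctured plane: a ray keeps its direction
    -- (x , y), and its elevation z / radius determines the distance
    -- 2 + z / norm of the image from the origin.
    project : Space → Point ℝ
    project p@(x , y , _) = x * factor p , y * factor p

  infix 4 _≈ˢ_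
  _≈ˢ_ : Space → Space → Set
  (x , y , z) ≈ˢ (x′ , y′ , z′) = x ≈ x′ × y ≈ y′ × z ≈ z′

  abstract

    project-cong : ∀ {p q} → p ≈ˢ q → _≈ᴾ_ ℝ (project p) (project q)
    project-cong {p} {q} (x≈ , y≈ , z≈) = *-cong x≈ f≈ , *-cong y≈ f≈
      where
      r≈ : radius p ≈ radius q
      r≈ = +-cong (∣∣-cong x≈) (∣∣-cong y≈)
      n≈ : norm p ≈ norm q
      n≈ = +-cong r≈ (∣∣-cong z≈)
      f≈ : factor p ≈ factor q
      f≈ = *-cong (+-cong n≈ (+-cong n≈ z≈)) (inv-cong (*-cong r≈ n≈))

  -- Equality of rays, with a multiplier on each side so that no quotient has to be formed.
  record Parallel (p q : Space) : Set where
    field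
      {λ′ μ′} : Carrier
      λ>0 : Pos λ′
      μ>0 : Pos μ′
      x≈  : proj₁ p * λ′ ≈ proj₁ q * μ′
      y≈  : proj₁ (proj₂ p) * λ′ ≈ proj₁ (proj₂ q) * μ′
      z≈  : proj₂ (proj₂ p) * λ′ ≈ proj₂ (proj₂ q) * μ′

  two : Carrier
  two = 1# + 1#

  module _ {p : Space} (r>0 : Pos (radius p)) where

    private
      x = proj₁ p
      y = proj₁ (proj₂ p)
      z = proj₂ (proj₂ p)
      r = radius p
      ρ = norm p
      g = factor p
      X = x * g
      Y = y * g
      G = ∣ X ∣ + ∣ Y ∣

    norm-pos : Pos ρ
    norm-pos = Pos-+∣∣ z r>0

    radius*norm-pos : Pos (r * ρ)
    radius*norm-pos = *-pos r>0 norm-pos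

    factor-pos : Pos g
    factor-pos = *-pos (Pos-+ norm-pos (∣∣-lower z r>0)) (inv-pos radius*norm-pos)

    distance : G ≈ r * g
    distance = trans (+-cong (∣∣-scale x factor-pos) (∣∣-scale y factor-pos)) (sym (distribʳ g _ _))

    distance-pos : Pos G
    distance-pos = Pos-resp (sym distance) (*-pos r>0 factor-pos)

    -- The distance G of the image from the origin is 2 + z / ρ, so the image determines z / ρ.
    elevation : z ≈ (G - two) * ρ
    elevation = begin
      z                             ≈⟨ solve 2 (λ z ρ → z := (ρ :+ (ρ :+ z)) :- (:1 :+ :1) :* ρ) refl z ρ ⟩
      (ρ + (ρ + z)) - two * ρ       ≈⟨ +-congʳ G*ρ ⟨
      G * ρ - two * ρ               ≈⟨ solve 3 (λ G ρ t → G :* ρ :- t :* ρ := (G :- t) :* ρ) refl G ρ two ⟩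
      (G - two) * ρ                 ∎
      where
      G*ρ : G * ρ ≈ ρ + (ρ + z)
      G*ρ = begin
        G * ρ                                  ≈⟨ *-congʳ distance ⟩
        r * g * ρ                              ≈⟨ solve 4 (λ r a i ρ → r :* (a :* i) :* ρ := a :* ((r :* ρ) :* i)) refl r (ρ + (ρ + z)) (inv (r * ρ)) ρ ⟩
        (ρ + (ρ + z)) * (r * ρ * inv (r * ρ))  ≈⟨ *-congˡ (inv-inverse (¬Pos-0 radius*norm-pos)) ⟩
        (ρ + (ρ + z)) * 1#                     ≈⟨ *-identityʳ _ ⟩
        ρ + (ρ + z)                            ∎

    -- As ρ = r + ∣ z ∣, the ratio r / ρ is 1 - ∣ z / ρ ∣, which is again determined by G.
    radius-recovered : r ≈ (1# - ∣ G - two ∣) * ρ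
    radius-recovered = begin
      r                         ≈⟨ solve 2 (λ r z → r := (r :+ z) :- z) refl r ∣ z ∣ ⟩
      ρ - ∣ z ∣                 ≈⟨ +-congˡ (-‿cong (trans (∣∣-cong elevation) (∣∣-scale _ norm-pos))) ⟩
      ρ - ∣ G - two ∣ * ρ       ≈⟨ solve 2 (λ ρ c → ρ :- c :* ρ := (:1 :- c) :* ρ) refl ρ ∣ G - two ∣ ⟩
      (1# - ∣ G - two ∣) * ρ    ∎

    direction : ∀ a → a * G ≈ (a * g) * ((1# - ∣ G - two ∣) * ρ)
    direction a = begin
      a * G                                   ≈⟨ *-congˡ distance ⟩
      a * (r * g)                             ≈⟨ solve 3 (λ a r g → a :* (r :* g) := (a :* g) :* r) refl a r g ⟩
      (a * g) * r                             ≈⟨ *-congˡ radius-recovered ⟩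
      (a * g) * ((1# - ∣ G - two ∣) * ρ)      ∎

  abstract

    -- The image determines the point up to its norm, by `elevation` and `direction`. Hence scaling
    -- each point by the norm of the other makes them equal.
    project-injective : ∀ {p q} → Pos (radius p) → Pos (radius q) →
                        _≈ᴾ_ ℝ (project p) (project q) → Parallel p q
    project-injective {p} {q} rp rq (X≈ , Y≈) = record
      { λ>0 = norm-pos rq
      ; μ>0 = norm-pos rp
      ; x≈  = horizontal (proj₁ p) (proj₁ q) X≈
      ; y≈  = horizontal (proj₁ (proj₂ p)) (proj₁ (proj₂ q)) Y≈
      ; z≈  = begin
          proj₂ (proj₂ p) * norm q        ≈⟨ *-congʳ (elevation rp) ⟩
          (G p - two) * norm p * norm q   ≈⟨ *-congʳ (*-congʳ (+-congʳ G≈)) ⟩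
          (G q - two) * norm p * norm q   ≈⟨ solve 3 (λ g m n → g :* m :* n := g :* n :* m) refl (G q - two) (norm p) (norm q) ⟩
          (G q - two) * norm q * norm p   ≈⟨ *-congʳ (elevation rq) ⟨
          proj₂ (proj₂ q) * norm p        ∎
      }
      where
      G : Space → Carrier
      G p@(x , y , _) = ∣ x * factor p ∣ + ∣ y * factor p ∣
      G≈ : G p ≈ G q
      G≈ = +-cong (∣∣-cong X≈) (∣∣-cong Y≈)
      horizontal : ∀ a b → a * factor p ≈ b * factor q → a * norm q ≈ b * norm p
      horizontal a b eq = *-cancelʳ (¬Pos-0 (distance-pos rp)) (begin
        a * norm q * G p                            ≈⟨ solve 3 (λ a n g → a :* n :* g := a :* g :* n) refl a (norm q) (G p) ⟩
        a * G p * norm q                            ≈⟨ *-congʳ (direction rp a) ⟩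
        (a * factor p) * (c p * norm p) * norm q    ≈⟨ *-congʳ (*-cong eq (*-congʳ (+-congˡ (-‿cong (∣∣-cong (+-congʳ G≈)))))) ⟩
        (b * factor q) * (c q * norm p) * norm q    ≈⟨ solve 4 (λ b c m n → b :* (c :* m) :* n := b :* (c :* n) :* m) refl (b * factor q) (c q) (norm p) (norm q) ⟩
        (b * factor q) * (c q * norm q) * norm p    ≈⟨ *-congʳ (direction rq b) ⟨
        b * G q * norm p                            ≈⟨ *-congʳ (*-congˡ G≈) ⟨
        b * G p * norm p                            ≈⟨ solve 3 (λ b g n → b :* g :* n := b :* n :* g) refl b (G p) (norm p) ⟩
        b * norm p * G p                            ∎)
        where
        c : Space → Carrier
        c p = 1# - ∣ G p - two ∣

    project-continuous : ∀ {t x y z} → Pos (radius (x t , y t , z t)) →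
      Continuous-at t x → Continuous-at t y → Continuous-at t z →
      Continuous-at t (λ s → proj₁ (project (x s , y s , z s))) ×
      Continuous-at t (λ s → proj₂ (project (x s , y s , z s)))
    project-continuous {t} {x} {y} {z} r>0 cx cy cz = *-continuous cx cf , *-continuous cy cf
      where
      cr : Continuous-at t (λ s → radius (x s , y s , z s))
      cr = +-continuous (∣∣-continuous cx) (∣∣-continuous cy)
      cn : Continuous-at t (λ s → norm (x s , y s , z s))
      cn = +-continuous cr (∣∣-continuous cz)
      cf : Continuous-at t (λ s → factor (x s , y s , z s))
      cf = *-continuous (+-continuous cn (+-continuous cn cz))
        (inv-continuous (radius*norm-pos r>0) (*-continuous cr cn))

  -- Combinations of two points of the moment curve

  combine : (A a B b : Carrier) → Space
  combine A a B b = A + B , A * a + B * b , A * (a * a) + B * (b * b)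

  combine-cong : ∀ {A A′ a a′ B B′ b b′} → A ≈ A′ → a ≈ a′ → B ≈ B′ → b ≈ b′ →
                 combine A a B b ≈ˢ combine A′ a′ B′ b′
  combine-cong A≈ a≈ B≈ b≈ = +-cong A≈ B≈ , +-cong (*-cong A≈ a≈) (*-cong B≈ b≈) ,
    +-cong (*-cong A≈ (*-cong a≈ a≈)) (*-cong B≈ (*-cong b≈ b≈))

  combine-swap : ∀ A a B b → combine A a B b ≈ˢ combine B b A a
  combine-swap A a B b = +-comm _ _ , +-comm _ _ , +-comm _ _

  module _ {A a B b C c D d : Carrier} (par : Parallel (combine A a B b) (combine C c D d)) where

    open Parallel par

    -- The functional y - px takes the value t - p at (1 , t , t²).
    linear-functional : ∀ p → (A * (a - p) + B * (b - p)) * λ′ ≈ (C * (c - p) + D * (d - p)) * μ′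
    linear-functional p = begin
      (A * (a - p) + B * (b - p)) * λ′                    ≈⟨ expand A a B b λ′ ⟩
      (A * a + B * b) * λ′ - p * ((A + B) * λ′)           ≈⟨ +-cong y≈ (-‿cong (*-congˡ x≈)) ⟩
      (C * c + D * d) * μ′ - p * ((C + D) * μ′)           ≈⟨ expand C c D d μ′ ⟨
      (C * (c - p) + D * (d - p)) * μ′                    ∎
      where
      expand : ∀ A a B b l → (A * (a - p) + B * (b - p)) * l ≈ (A * a + B * b) * l - p * ((A + B) * l)
      expand A a B b l = solve 6 (λ A a B b l p →
        (A :* (a :- p) :+ B :* (b :- p)) :* l := (A :* a :+ B :* b) :* l :- p :* ((A :+ B) :* l))
        refl A a B b l p

    -- The functional z - (p + q)y + pqx takes the value (t - p)(t - q) at (1 , t , t²). Taking p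
    -- and q among a, b, c, d leaves a relation between two coefficients.
    quadratic-functional : ∀ p q →
      (A * ((a - p) * (a - q)) + B * ((b - p) * (b - q))) * λ′ ≈
      (C * ((c - p) * (c - q)) + D * ((d - p) * (d - q))) * μ′
    quadratic-functional p q = begin
      (A * ((a - p) * (a - q)) + B * ((b - p) * (b - q))) * λ′
        ≈⟨ expand A a B b λ′ ⟩
      (A * (a * a) + B * (b * b)) * λ′ - (p + q) * ((A * a + B * b) * λ′) + p * q * ((A + B) * λ′)
        ≈⟨ +-cong (+-cong z≈ (-‿cong (*-congˡ y≈))) (*-congˡ x≈) ⟩
      (C * (c * c) + D * (d * d)) * μ′ - (p + q) * ((C * c + D * d) * μ′) + p * q * ((C + D) * μ′)
        ≈⟨ expand C c D d μ′ ⟨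
      (C * ((c - p) * (c - q)) + D * ((d - p) * (d - q))) * μ′ ∎
      where
      expand : ∀ A a B b l → (A * ((a - p) * (a - q)) + B * ((b - p) * (b - q))) * l ≈
        (A * (a * a) + B * (b * b)) * l - (p + q) * ((A * a + B * b) * l) + p * q * ((A + B) * l)
      expand A a B b l = solve 7 (λ A a B b l p q →
        (A :* ((a :- p) :* (a :- q)) :+ B :* ((b :- p) :* (b :- q))) :* l :=
        (A :* (a :* a) :+ B :* (b :* b)) :* l :- (p :+ q) :* ((A :* a :+ B :* b) :* l) :+ p :* q :* ((A :+ B) :* l))
        refl A a B b l p q

  Parallel-resp : ∀ {p p′ q q′} → p ≈ˢ p′ → q ≈ˢ q′ → Parallel p q → Parallel p′ q′
  Parallel-resp (a , b , c) (d , e , f) par = record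
    { λ>0 = λ>0 ; μ>0 = μ>0
    ; x≈ = trans (*-congʳ (sym a)) (trans x≈ (*-congʳ d))
    ; y≈ = trans (*-congʳ (sym b)) (trans y≈ (*-congʳ e))
    ; z≈ = trans (*-congʳ (sym c)) (trans z≈ (*-congʳ f))
    }
    where
    open Parallel par

  -- The plane vectors (1 , a) and (1 , b) are independent. This is why no arc meets the third axis.
  radius-pos : ∀ {A a B b} → ¬ a ≈ b → ¬ (A ≈ 0# × B ≈ 0#) → Pos (radius (combine A a B b))
  radius-pos {A} {a} {B} {b} a≉b AB≉0 with (A + B) ≟ 0# | (A * a + B * b) ≟ 0#
  ... | no x≉0 | _ = Pos-+∣∣ _ (Pos-∣∣ x≉0)
  ... | yes _  | no y≉0 = Pos-∣∣+ _ (Pos-∣∣ y≉0)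
  ... | yes x≈0 | yes y≈0 = ⊥-elim (AB≉0
    ( *-cancelʳ a-b≉0 (begin
        A * (a - b)                        ≈⟨ solve 4 (λ A a B b → A :* (a :- b) := (A :* a :+ B :* b) :- b :* (A :+ B)) refl A a B b ⟩
        (A * a + B * b) - b * (A + B)      ≈⟨ vanish b ⟩
        0# * (a - b)                       ∎)
    , *-cancelʳ a-b≉0 (begin
        B * (a - b)                        ≈⟨ solve 4 (λ A a B b → B :* (a :- b) := :- ((A :* a :+ B :* b) :- a :* (A :+ B))) refl A a B b ⟩
        - ((A * a + B * b) - a * (A + B))  ≈⟨ -‿cong (vanish a) ⟩
        - (0# * (a - b))                   ≈⟨ solve 1 (λ d → :- (:0 :* d) := :0 :* d) refl (a - b) ⟩
        0# * (a - b)                       ∎)))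
    where
    a-b≉0 : ¬ a - b ≈ 0#
    a-b≉0 e = a≉b (begin
      a            ≈⟨ solve 2 (λ a b → a := (a :- b) :+ b) refl a b ⟩
      (a - b) + b  ≈⟨ +-congʳ e ⟩
      0# + b       ≈⟨ +-identityˡ b ⟩
      b            ∎)
    vanish : ∀ c → (A * a + B * b) - c * (A + B) ≈ 0# * (a - b)
    vanish c = trans (+-cong y≈0 (-‿cong (*-congˡ x≈0)))
      (solve 2 (λ c d → :0 :- c :* :0 := :0 :* d) refl c (a - b))

-- Parities and signs as Booleans.

parity : ℕ → Bool
parity zero    = false
parity (suc n) = not (parity n)

module Signs (ℝ : CompleteOrderedField) where

  open OrderedField ℝ

  unit : Bool → Carrier
  unit false = 1#
  unit true  = - 1#

  -- Nonzero signs form the group of Booleans under `xor`, with `false` for plus; comparing signs of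
  -- products becomes a Boolean equation.
  data Signed : Bool → Carrier → Set where
    positive : ∀ {x} → Pos x → Signed false x
    negative : ∀ {x} → Pos (- x) → Signed true x

  Signed-resp : ∀ {b x y} → x ≈ y → Signed b x → Signed b y
  Signed-resp e (positive p) = positive (Pos-resp e p)
  Signed-resp e (negative p) = negative (Pos-resp (-‿cong e) p)

  Signed-* : ∀ {a b x y} → Signed a x → Signed b y → Signed (a xor b) (x * y)
  Signed-* {x = x} {y} (positive p) (positive q) = positive (*-pos p q)
  Signed-* {x = x} {y} (positive p) (negative q) = negative (Pos-resp (solve 2 (λ x y → x :* (:- y) := :- (x :* y)) refl x y) (*-pos p q))
  Signed-* {x = x} {y} (negative p) (positive q) = negative (Pos-resp (solve 2 (λ x y → (:- x) :* y := :- (x :* y)) refl x y) (*-pos p q))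
  Signed-* {x = x} {y} (negative p) (negative q) = positive (Pos-resp (solve 2 (λ x y → (:- x) :* (:- y) := x :* y) refl x y) (*-pos p q))

  Signed-*ʳ : ∀ {a x y} → Signed a x → Pos y → Signed a (x * y)
  Signed-*ʳ s p = ≡.subst (λ a → Signed a _) (xor-identityʳ _) (Signed-* s (positive p))

  Signed-neg : ∀ {a x} → Signed a x → Signed (not a) (- x)
  Signed-neg {x = x} (positive p) = negative (Pos-resp (solve 1 (λ x → x := :- (:- x)) refl x) p)
  Signed-neg         (negative p) = positive p

  Signed-unique : ∀ {a b x} → Signed a x → Signed b x → a ≡ b
  Signed-unique (positive p) (positive q) = ≡.refl
  Signed-unique (positive p) (negative q) = ⊥-elim (¬Pos-neg p q)
  Signed-unique (negative p) (positive q) = ⊥-elim (¬Pos-neg q p)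
  Signed-unique (negative p) (negative q) = ≡.refl

  Signed-nonzero : ∀ {a x} → Signed a x → ¬ x ≈ 0#
  Signed-nonzero (positive p) e = ¬Pos-0 p e
  Signed-nonzero (negative p) e = ¬Pos-0 p (trans (-‿cong e) (solve 0 (:- :0 := :0) refl))

  Signed-unit : ∀ b → Signed b (unit b)
  Signed-unit false = positive 0<1
  Signed-unit true  = negative (Pos-resp (solve 0 (:1 := :- (:- :1)) refl) 0<1)

  ι : ℕ → Carrier
  ι zero    = 0#
  ι (suc n) = 1# + ι n

  ι-< : ∀ {m n} → m ℕ.< n → Pos (ι n - ι m)
  ι-< {m} {suc n} (ℕ.s≤s m≤n) with ℕ.m≤n⇒m<n∨m≡n m≤n
  ... | inj₁ m<n    = Pos-resp (solve 2 (λ n m → :1 :+ (n :- m) := (:1 :+ n) :- m) refl (ι n) (ι m)) (Pos-+ 0<1 (ι-< m<n))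
  ... | inj₂ ≡.refl = Pos-resp (solve 1 (λ n → :1 := (:1 :+ n) :- n) refl (ι n)) 0<1

  earlier : ∀ {m n} → m ℕ.< n → Signed true (ι m - ι n)
  earlier {m} {n} m<n = negative (Pos-resp (solve 2 (λ n m → n :- m := :- (m :- n)) refl (ι n) (ι m)) (ι-< m<n))

  later : ∀ {m n} → m ℕ.< n → Signed false (ι n - ι m)
  later m<n = positive (ι-< m<n)

  ι-injective : ∀ {m n} → ι m ≈ ι n → m ≡ n
  ι-injective {m} {n} e with ℕ.<-cmp m n
  ... | tri< m<n _ _ = ⊥-elim (¬Pos-0 (ι-< m<n) (trans (+-congʳ (sym e)) (-‿inverseʳ _)))
  ... | tri≈ _ m≡n _ = m≡n
  ... | tri> _ _ n<m = ⊥-elim (¬Pos-0 (ι-< n<m) (trans (+-congʳ e) (-‿inverseʳ _)))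

bit : Fin 2 → Bool
bit Fin.zero           = false
bit (Fin.suc Fin.zero) = true

colour : Bool → Fin 2
colour false = Fin.zero
colour true  = Fin.suc Fin.zero

colour-bit : ∀ x → colour (bit x) ≡ x
colour-bit Fin.zero           = ≡.refl
colour-bit (Fin.suc Fin.zero) = ≡.refl

bit-≢ : ∀ {x y} → Graph._~_ (P 2) x y → bit x ≢ bit y
bit-≢ {Fin.zero}         {Fin.zero}         (inj₁ ()) _
bit-≢ {Fin.zero}         {Fin.zero}         (inj₂ ()) _
bit-≢ {Fin.zero}         {Fin.suc Fin.zero} _ ()
bit-≢ {Fin.suc Fin.zero} {Fin.zero}         _ ()
bit-≢ {Fin.suc Fin.zero} {Fin.suc Fin.zero} (inj₁ ()) _
bit-≢ {Fin.suc Fin.zero} {Fin.suc Fin.zero} (inj₂ ()) _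

-- The drawing.

module CrownDrawing (ℝ : CompleteOrderedField) (n : ℕ) where

  open OrderedField ℝ
  open CentralProjection ℝ
  open Signs ℝ
  open import Relation.Binary.Reasoning.Setoid setoid

  G : Graph
  G = K n ×ᴷ P 2

  open Graph G using (V; _~_; ~-sym)

  index : V → ℕ
  index (i , _) = toℕ i

  -- The vertex (i , x) is aᵢ for x = 0 and bᵢ for x = 1; `true` means that it lies on the ray of
  -- -vᵢ.
  orientation : V → Bool
  orientation (i , x) = parity (toℕ i) xor bit x

  time : V → Carrier
  time v = ι (index v)

  weight : V → Carrier
  weight v = unit (orientation v)

  bit≡ : ∀ v → bit (proj₂ v) ≡ parity (index v) xor orientation v
  bit≡ (i , x) = ≡.sym (≡.trans (≡.sym (xor-assoc p p (bit x))) (≡.cong (_xor bit x) (xor-same p)))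
    where
    p : Bool
    p = parity (toℕ i)

  vertex-unique : ∀ u v → index u ≡ index v → orientation u ≡ orientation v → u ≡ v
  vertex-unique u v i≡j o≡o with Fin.toℕ-injective i≡j
  ... | ≡.refl = ≡.cong (proj₁ u ,_) (≡.trans (≡.sym (colour-bit (proj₂ u)))
    (≡.trans (≡.cong colour (≡.trans (bit≡ u) (≡.trans (≡.cong (parity (index u) xor_) o≡o) (≡.sym (bit≡ v)))))
      (colour-bit (proj₂ v))))

  weight-nonzero : ∀ v → ¬ weight v ≈ 0#
  weight-nonzero v = Signed-nonzero (Signed-unit (orientation v))

  time-≉ : ∀ u v → proj₁ u ≢ proj₁ v → ¬ time u ≈ time v
  time-≉ u v i≢j e = i≢j (Fin.toℕ-injective (ι-injective e))

  difference-nonzero : ∀ u v → proj₁ u ≢ proj₁ v → ¬ time u - time v ≈ 0#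
  difference-nonzero u v i≢j e = time-≉ u v i≢j (begin
    time u                      ≈⟨ solve 2 (λ a b → a := (a :- b) :+ b) refl (time u) (time v) ⟩
    (time u - time v) + time v  ≈⟨ +-congʳ e ⟩
    0# + time v                 ≈⟨ +-identityˡ _ ⟩
    time v                      ∎)

  -- The straight segment between the signed curve points of u and v; the rays through it form the
  -- shortest great arc.
  curve : V → V → Carrier → Space
  curve u v s = combine ((1# - s) * weight u) (time u) (s * weight v) (time v)

  -- The zero second term brings a vertex into the form to which the functionals apply.
  place : V → Space
  place v = combine (weight v) (time v) 0# (time v)

  1≉0 : ¬ 1# ≈ 0#
  1≉0 = ¬Pos-0 0<1

  curve-radius : ∀ u v → u ~ v → ∀ s → Pos (radius (curve u v s))
  curve-radius u v (i≢j , _) s = radius-pos (time-≉ u v i≢j) λ (A≈0 , B≈0) → 1≉0 (begin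
    1#            ≈⟨ solve 1 (λ s → :1 := (:1 :- s) :+ s) refl s ⟩
    (1# - s) + s  ≈⟨ +-cong (drop u A≈0) (drop v B≈0) ⟩
    0# + 0#       ≈⟨ +-identityˡ 0# ⟩
    0#            ∎)
    where
    drop : ∀ v {a} → a * weight v ≈ 0# → a ≈ 0#
    drop v e = *-cancelʳ (weight-nonzero v) (trans e (sym (zeroˡ _)))

  place-radius : ∀ v → Pos (radius (place v))
  place-radius v = Pos-+∣∣ _ (Pos-∣∣ λ e → weight-nonzero v (trans (sym (+-identityʳ _)) e))

  curve-cong : ∀ u v {s t} → s ≈ t → curve u v s ≈ˢ curve u v t
  curve-cong u v e = combine-cong (*-congʳ (+-congˡ (-‿cong e))) refl (*-congʳ e) refl

  curve-reverse : ∀ u v t → curve v u t ≈ˢ curve u v (1# - t)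
  curve-reverse u v t = let a , b , c = combine-swap ((1# - t) * weight v) (time v) (t * weight u) (time u) in
    let a′ , b′ , c′ = combine-cong {b = time v} (*-congʳ (solve 1 (λ t → t := :1 :- (:1 :- t)) refl t)) (refl {time u}) (refl {(1# - t) * weight v}) refl in
    trans a a′ , trans b b′ , trans c c′

  source : ∀ u v → curve u v 0# ≈ˢ place u
  source u v =
    solve 2 (λ A B → (:1 :- :0) :* A :+ :0 :* B := A :+ :0) refl (weight u) (weight v) ,
    solve 4 (λ A B a b → (:1 :- :0) :* A :* a :+ :0 :* B :* b := A :* a :+ :0 :* a) refl (weight u) (weight v) (time u) (time v) ,
    solve 4 (λ A B a b → (:1 :- :0) :* A :* (a :* a) :+ :0 :* B :* (b :* b) := A :* (a :* a) :+ :0 :* (a :* a)) refl (weight u) (weight v) (time u) (time v)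

  target : ∀ u v → curve u v 1# ≈ˢ place v
  target u v =
    solve 2 (λ A B → (:1 :- :1) :* A :+ :1 :* B := B :+ :0) refl (weight u) (weight v) ,
    solve 4 (λ A B a b → (:1 :- :1) :* A :* a :+ :1 :* B :* b := B :* b :+ :0 :* b) refl (weight u) (weight v) (time u) (time v) ,
    solve 4 (λ A B a b → (:1 :- :1) :* A :* (a :* a) :+ :1 :* B :* (b :* b) := B :* (b :* b) :+ :0 :* (b :* b)) refl (weight u) (weight v) (time u) (time v)

  signed-weight : ∀ v {a} → Pos a → Signed (orientation v) (a * weight v)
  signed-weight v a>0 = Signed-* (positive a>0) (Signed-unit (orientation v))

  orientation-unique : ∀ u v {l m a b} → Pos l → Pos m → Pos a → Pos b →
    (a * weight u) * l ≈ (b * weight v) * m → orientation u ≡ orientation v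
  orientation-unique u v {l} {m} {a} {b} l>0 m>0 a>0 b>0 eq =
    Signed-unique (Signed-*ʳ (signed-weight u a>0) l>0) (Signed-resp (sym eq) (Signed-*ʳ (signed-weight v b>0) m>0))

  -- The functional vanishing at b extracts the coefficient of a.
  coefficientˡ : ∀ {A a B b C D} → ¬ a - b ≈ 0# → (par : Parallel (combine A a B b) (combine C a D b)) →
                 A * Parallel.λ′ par ≈ C * Parallel.μ′ par
  coefficientˡ {A} {a} {B} {b} {C} {D} a-b≉0 par = *-cancelʳ a-b≉0
    (trans (sym (drop A B λ′)) (trans (linear-functional par b) (drop C D μ′)))
    where
    open Parallel par
    drop : ∀ A B l → (A * (a - b) + B * (b - b)) * l ≈ A * l * (a - b)
    drop A B l = solve 5 (λ A B l a b → (A :* (a :- b) :+ B :* (b :- b)) :* l := A :* l :* (a :- b)) refl A B l a b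

  coefficientʳ : ∀ {A a B b C D} → ¬ b - a ≈ 0# → (par : Parallel (combine A a B b) (combine C a D b)) →
                 B * Parallel.λ′ par ≈ D * Parallel.μ′ par
  coefficientʳ {A} {a} {B} {b} {C} {D} b-a≉0 par = *-cancelʳ b-a≉0
    (trans (sym (drop A B λ′)) (trans (linear-functional par a) (drop C D μ′)))
    where
    open Parallel par
    drop : ∀ A B l → (A * (a - a) + B * (b - a)) * l ≈ B * l * (b - a)
    drop A B l = solve 5 (λ A B l a b → (A :* (a :- a) :+ B :* (b :- a)) :* l := B :* l :* (b :- a)) refl A B l a b

  -- For different indices, the functional vanishing at `time v` does not vanish at u. For equal
  -- indices, the first coordinate reveals the orientation.
  place-injective : ∀ u v → Parallel (place u) (place v) → u ≡ v
  place-injective u v par with proj₁ u Fin.≟ proj₁ v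
  ... | no i≢j = ⊥-elim (*-nonzero (*-nonzero (weight-nonzero u) (difference-nonzero u v i≢j)) (¬Pos-0 λ>0) (begin
      weight u * (time u - time v) * λ′
        ≈⟨ solve 4 (λ e a b l → e :* (a :- b) :* l := (e :* (a :- b) :+ :0 :* (a :- b)) :* l) refl (weight u) (time u) (time v) λ′ ⟩
      (weight u * (time u - time v) + 0# * (time u - time v)) * λ′
        ≈⟨ linear-functional par (time v) ⟩
      (weight v * (time v - time v) + 0# * (time v - time v)) * μ′
        ≈⟨ solve 3 (λ e b l → (e :* (b :- b) :+ :0 :* (b :- b)) :* l := :0) refl (weight v) (time v) μ′ ⟩
      0# ∎))
    where
    open Parallel par
  ... | yes i≡j = vertex-unique u v (≡.cong toℕ i≡j) (orientation-unique u v λ>0 μ>0 0<1 0<1 (begin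
      1# * weight u * λ′     ≈⟨ solve 2 (λ e l → :1 :* e :* l := (e :+ :0) :* l) refl (weight u) λ′ ⟩
      (weight u + 0#) * λ′   ≈⟨ x≈ ⟩
      (weight v + 0#) * μ′   ≈⟨ solve 2 (λ e l → :1 :* e :* l := (e :+ :0) :* l) refl (weight v) μ′ ⟨
      1# * weight v * μ′     ∎))
    where
    open Parallel par

  -- Comparing the coefficients of the two ends gives (1 - s)λ = (1 - t)μ and sλ = tμ; their sum is
  -- λ = μ.
  curve-injective : ∀ u v → u ~ v → ∀ s t → Parallel (curve u v s) (curve u v t) → s ≈ t
  curve-injective u v (i≢j , _) s t par = *-cancelʳ (¬Pos-0 λ>0) (begin
    s * λ′  ≈⟨ tail ⟩
    t * μ′  ≈⟨ *-congˡ scales ⟨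
    t * λ′  ∎)
    where
    open Parallel par
    remove : ∀ v {a b} → (a * weight v) * λ′ ≈ (b * weight v) * μ′ → a * λ′ ≈ b * μ′
    remove v {a} {b} e = *-cancelʳ (weight-nonzero v) (begin
      a * λ′ * weight v  ≈⟨ solve 3 (λ a l e → a :* l :* e := a :* e :* l) refl a λ′ (weight v) ⟩
      a * weight v * λ′  ≈⟨ e ⟩
      b * weight v * μ′  ≈⟨ solve 3 (λ a l e → a :* l :* e := a :* e :* l) refl b μ′ (weight v) ⟨
      b * μ′ * weight v  ∎)
    head : (1# - s) * λ′ ≈ (1# - t) * μ′
    head = remove u (coefficientˡ (difference-nonzero u v i≢j) par)
    tail : s * λ′ ≈ t * μ′
    tail = remove v (coefficientʳ (difference-nonzero v u (≡.≢-sym i≢j)) par)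
    scales : λ′ ≈ μ′
    scales = begin
      λ′                            ≈⟨ solve 2 (λ s l → l := (:1 :- s) :* l :+ s :* l) refl s λ′ ⟩
      (1# - s) * λ′ + s * λ′        ≈⟨ +-cong head tail ⟩
      (1# - t) * μ′ + t * μ′        ≈⟨ solve 2 (λ s l → l := (:1 :- s) :* l :+ s :* l) refl t μ′ ⟨
      μ′                            ∎

  reverse-Parallel : ∀ u v t {q} → Parallel (curve u v t) q → Parallel (curve v u (1# - t)) q
  reverse-Parallel u v t = Parallel-resp
    (let a , b , c = curve-reverse u v (1# - t) ; a′ , b′ , c′ = curve-cong u v (solve 1 (λ t → :1 :- (:1 :- t) := t) refl t) in
      sym (trans a a′) , sym (trans b b′) , sym (trans c c′))
    (refl , refl , refl)

  -- The functional vanishing at the common time of u and w leaves only the coefficient of v, so t =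
  -- 0. Then the first coordinate excludes that w is antipodal to u.
  curve-avoids-near : ∀ u v w t → u ~ v → index w ≡ index u → Parallel (curve u v t) (place w) → w ≡ u
  curve-avoids-near u v w t (i≢j , _) k≡i par =
    ≡.sym (vertex-unique u w (≡.sym k≡i) (orientation-unique u w λ>0 μ>0 0<1 0<1 (begin
      1# * weight u * λ′                               ≈⟨ solve 3 (λ e f l → :1 :* e :* l := ((:1 :- :0) :* e :+ :0 :* f) :* l) refl (weight u) (weight v) λ′ ⟩
      ((1# - 0#) * weight u + 0# * weight v) * λ′      ≈⟨ *-congʳ (+-cong (*-congʳ (+-congˡ (-‿cong t≈0))) (*-congʳ t≈0)) ⟨
      ((1# - t) * weight u + t * weight v) * λ′        ≈⟨ x≈ ⟩
      (weight w + 0#) * μ′                             ≈⟨ solve 2 (λ e l → :1 :* e :* l := (e :+ :0) :* l) refl (weight w) μ′ ⟨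
      1# * weight w * μ′                               ∎)))
    where
    open Parallel par
    c≈a : time w ≈ time u
    c≈a = reflexive (≡.cong ι k≡i)
    t≈0 : t ≈ 0#
    t≈0 = *-cancelʳ (*-nonzero (*-nonzero (weight-nonzero v) (difference-nonzero v u (≡.≢-sym i≢j))) (¬Pos-0 λ>0)) (begin
      t * (weight v * (time v - time u) * λ′)
        ≈⟨ solve 6 (λ t e f a b l → t :* (f :* (b :- a) :* l) := ((:1 :- t) :* e :* (a :- a) :+ t :* f :* (b :- a)) :* l) refl t (weight u) (weight v) (time u) (time v) λ′ ⟩
      ((1# - t) * weight u * (time u - time u) + t * weight v * (time v - time u)) * λ′
        ≈⟨ linear-functional par (time u) ⟩
      (weight w * (time w - time u) + 0# * (time w - time u)) * μ′
        ≈⟨ *-congʳ (+-cong (*-congˡ (+-congʳ c≈a)) (*-congˡ (+-congʳ c≈a))) ⟩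
      (weight w * (time u - time u) + 0# * (time u - time u)) * μ′
        ≈⟨ solve 4 (λ e a m r → (e :* (a :- a) :+ :0 :* (a :- a)) :* m := :0 :* r) refl (weight w) (time u) μ′ (weight v * (time v - time u) * λ′) ⟩
      0# * (weight v * (time v - time u) * λ′) ∎)

  curve-avoids : ∀ u v → u ~ v → ∀ w t → Parallel (curve u v t) (place w) → w ≡ u ⊎ w ≡ v
  curve-avoids u v u~v w t par with proj₁ w Fin.≟ proj₁ u | proj₁ w Fin.≟ proj₁ v
  ... | yes k≡i | _       = inj₁ (curve-avoids-near u v w t u~v (≡.cong toℕ k≡i) par)
  ... | no _    | yes k≡j = inj₂ (curve-avoids-near v u w (1# - t) (~-sym u~v) (≡.cong toℕ k≡j) (reverse-Parallel u v t par))
  -- The quadratic vanishing at both ends of the arc vanishes on the whole arc, but not at w.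
  ... | no k≢i  | no k≢j  = ⊥-elim (*-nonzero
      (*-nonzero (weight-nonzero w) (*-nonzero (difference-nonzero w u k≢i) (difference-nonzero w v k≢j))) (¬Pos-0 μ>0) (begin
      weight w * ((c - a) * (c - b)) * μ′
        ≈⟨ solve 3 (λ e p m → e :* p :* m := (e :* p :+ :0 :* p) :* m) refl (weight w) ((c - a) * (c - b)) μ′ ⟩
      (weight w * ((c - a) * (c - b)) + 0# * ((c - a) * (c - b))) * μ′
        ≈⟨ quadratic-functional par a b ⟨
      ((1# - t) * weight u * ((a - a) * (a - b)) + t * weight v * ((b - a) * (b - b))) * λ′
        ≈⟨ solve 6 (λ A B a b m l → (A :* ((a :- a) :* (a :- b)) :+ B :* ((b :- a) :* (b :- b))) :* l := :0) refl ((1# - t) * weight u) (t * weight v) a b μ′ λ′ ⟩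
      0# ∎))
    where
    open Parallel par
    a = time u
    b = time v
    c = time w

  Within⇒Small : ∀ {δ s t} → Within ℝ δ s t → Small δ (s - t)
  Within⇒Small {δ} {s} {t} (p , q) =
    Pos-resp (solve 3 (λ d s t → (t :+ d) :- s := d :- (s :- t)) refl δ s t) (<⇒Pos p) ,
    Pos-resp (solve 3 (λ d s t → (s :+ d) :- t := d :+ (s :- t)) refl δ s t) (<⇒Pos q)

  Small⇒Within : ∀ {δ s t} → Small δ (s - t) → Within ℝ δ s t
  Small⇒Within {δ} {s} {t} (p , q) =
    Pos⇒< (Pos-resp (solve 3 (λ d s t → d :- (s :- t) := (t :+ d) :- s) refl δ s t) p) ,
    Pos⇒< (Pos-resp (solve 3 (λ d s t → d :+ (s :- t) := (s :+ d) :- t) refl δ s t) q)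

  curve-continuous : ∀ u v → u ~ v → ∀ t →
    Continuous-at t (λ s → proj₁ (project (curve u v s))) × Continuous-at t (λ s → proj₂ (project (curve u v s)))
  curve-continuous u v u~v t = project-continuous
    {x = λ s → (1# - s) * weight u + s * weight v}
    {y = λ s → (1# - s) * weight u * time u + s * weight v * time v}
    {z = λ s → (1# - s) * weight u * (time u * time u) + s * weight v * (time v * time v)}
    (curve-radius u v u~v t)
    (+-continuous first second)
    (+-continuous (*-continuous first (const-continuous _)) (*-continuous second (const-continuous _)))
    (+-continuous (*-continuous first (const-continuous _)) (*-continuous second (const-continuous _)))
    where
    minus : Continuous-at t (λ s → - s)
    minus ε p = ε , p , λ s (q , r) →
      Pos-resp (solve 3 (λ e s t → e :+ (s :- t) := e :- ((:- s) :- (:- t))) refl ε s t) r ,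
      Pos-resp (solve 3 (λ e s t → e :- (s :- t) := e :+ ((:- s) :- (:- t))) refl ε s t) q
    first : Continuous-at t (λ s → (1# - s) * weight u)
    first = *-continuous (+-continuous (const-continuous 1#) minus) (const-continuous (weight u))
    second : Continuous-at t (λ s → s * weight v)
    second = *-continuous id-continuous (const-continuous (weight v))

  drawing : Drawing ℝ G
  drawing = record
    { pos           = λ v → project (place v)
    ; arc           = λ u v s → project (curve u v s)
    ; pos-injective = λ u v e → place-injective u v (project-injective (place-radius u) (place-radius v) e)
    ; isArc         = λ {u} {v} u~v → record
      { continuous = λ t _ ε ε>0 → let cx , cy = curve-continuous u v u~v t ; δ , δ>0 , near = jointly cx cy ε ε>0 in
          δ , δ>0 , λ s _ within → let p , q = near s (Within⇒Small within) in Small⇒Within p , Small⇒Within q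
      ; injective  = λ s t _ _ e → curve-injective u v u~v s t
          (project-injective (curve-radius u v u~v s) (curve-radius u v u~v t) e)
      }
    ; arc-source    = λ {u} {v} _ → project-cong (source u v)
    ; arc-target    = λ {u} {v} _ → project-cong (target u v)
    ; arc-reverse   = λ {u} {v} _ t _ → project-cong (curve-reverse u v t)
    ; arc-avoids    = λ {u} {v} u~v w t _ e → curve-avoids u v u~v w t
        (project-injective (curve-radius u v u~v t) (place-radius w) e)
    }

-- Finite setoids

module _ (S : DecSetoid 0ℓ 0ℓ) where

  open DecSetoid S using (Carrier; _≈_; _≟_; setoid; reflexive; sym; trans)
  open SetoidMembership setoid renaming (_∈_ to _∈ˢ_)

  lookup-injective : ∀ {xs} → AllPairs (λ x y → ¬ x ≈ y) xs →
                     ∀ i j → lookup xs i ≈ lookup xs j → i ≡ j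
  lookup-injective (_ ∷ _)   Fin.zero    Fin.zero    e = ≡.refl
  lookup-injective (x∉ ∷ _)  Fin.zero    (Fin.suc j) e = ⊥-elim (All.lookup x∉ (∈-lookup j) e)
  lookup-injective (x∉ ∷ u)  (Fin.suc i) Fin.zero    e = ≡.sym (lookup-injective (x∉ ∷ u) Fin.zero (Fin.suc i) (sym e))
  lookup-injective (_ ∷ u)   (Fin.suc i) (Fin.suc j) e = ≡.cong Fin.suc (lookup-injective u i j e)

  length-deduplicate : ∀ xs → length (deduplicate _≟_ xs) ℕ.≤ length xs
  length-deduplicate []       = ℕ.z≤n
  length-deduplicate (x ∷ xs) = ℕ.s≤s (ℕ.≤-trans
    (List.length-filter (¬? ∘ (x ≟_)) (deduplicate _≟_ xs)) (length-deduplicate xs))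

  -- Repetitions in `xs` are allowed, which is why its length only bounds the cardinality.
  exhausted⇒finite : ∀ xs → (∀ x → x ∈ˢ xs) →
                     ∃[ k ] Bijection (≡.setoid (Fin k)) setoid × k ℕ.≤ length xs
  exhausted⇒finite xs complete = length ys , bijection , length-deduplicate xs
    where
    ys : List Carrier
    ys = deduplicate _≟_ xs
    complete′ : ∀ x → x ∈ˢ ys
    complete′ x = SetoidMembershipProperties.∈-deduplicate⁺ setoid _≟_ (λ y≈z x≈y → trans x≈y (sym y≈z)) (complete x)
    bijection : Bijection (≡.setoid (Fin (length ys))) setoid
    bijection = record
      { to        = lookup ys
      ; cong      = λ e → reflexive (≡.cong (lookup ys) e)
      ; bijective = (λ {i} {j} → lookup-injective (deduplicate-! S xs) i j) ,
                    (λ y → Any.index (complete′ y) , λ e →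
                      trans (reflexive (≡.cong (lookup ys) e)) (sym (Any.lookup-index (complete′ y))))
      }

unorderedPair-decidable : ∀ S → Decidable (Setoid._≈_ S) → Decidable (Setoid._≈_ (unorderedPair S))
unorderedPair-decidable S _≟_ (a , b) (c , d) =
  ((a ≟ c) ×-dec (b ≟ d)) ⊎-dec ((a ≟ d) ×-dec (b ≟ c))

-- Increasing sequences with prescribed parities

-- Sequences are listed with their largest entry first.
sequences : ∀ {k} → Vec Bool k → ℕ → List (Vec ℕ k)
extend : ∀ {k} → Bool → Bool → Vec Bool k → ℕ → List (Vec ℕ (suc k))
sequences []       n       = [] ∷ []
sequences (b ∷ bs) zero    = []
sequences (b ∷ bs) (suc n) = sequences (b ∷ bs) n ++ extend b (parity n) bs n
extend false false bs n = map (n ∷_) (sequences bs n)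
extend true  true  bs n = map (n ∷_) (sequences bs n)
extend _     _     bs n = []

extend-same : ∀ {k} b (bs : Vec Bool k) n → extend b b bs n ≡ map (n ∷_) (sequences bs n)
extend-same false bs n = ≡.refl
extend-same true  bs n = ≡.refl

sequences-complete : ∀ {k} {bs : Vec Bool k} {x xs n} → x ℕ.< n → xs ∈ sequences bs x →
                     x ∷ xs ∈ sequences (parity x ∷ bs) n
sequences-complete {bs = bs} {x} {xs} {suc n} (ℕ.s≤s x≤n) xs∈ with ℕ.m≤n⇒m<n∨m≡n x≤n
... | inj₁ x<n    = ∈-++⁺ˡ (sequences-complete x<n xs∈)
... | inj₂ ≡.refl = ∈-++⁺ʳ _ (≡.subst (_ ∈_) (≡.sym (extend-same (parity x) bs x)) (∈-map⁺ (x ∷_) xs∈))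

sequences₄-complete : ∀ {p q r s n} → p ℕ.< q → q ℕ.< r → r ℕ.< s → s ℕ.< n →
  s ∷ r ∷ q ∷ p ∷ [] ∈ sequences (parity s ∷ parity r ∷ parity q ∷ parity p ∷ []) n
sequences₄-complete p<q q<r r<s s<n =
  sequences-complete s<n (sequences-complete r<s (sequences-complete q<r (sequences-complete p<q (here ≡.refl))))

pairs : List (Bool × Bool)
pairs = (false , false) ∷ (false , true) ∷ (true , false) ∷ (true , true) ∷ []

pairs-complete : ∀ p → p ∈ pairs
pairs-complete (false , false) = here ≡.refl
pairs-complete (false , true)  = there (here ≡.refl)
pairs-complete (true , false)  = there (there (here ≡.refl))
pairs-complete (true , true)   = there (there (there (here ≡.refl)))

-- The three parity patterns for p < q < r < s, largest index first, each parametrised by its two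
-- free parities.
separated alternating nested : Bool × Bool → Vec Bool 4
separated   (p , r) = r ∷ r ∷ p ∷ p ∷ []
alternating (p , q) = not q ∷ not p ∷ q ∷ p ∷ []
nested      (p , q) = p ∷ q ∷ q ∷ p ∷ []

quadruples : (Bool × Bool → Vec Bool 4) → ℕ → List (Vec ℕ 4)
quadruples word n = concatMap (λ p → sequences (word p) n) pairs

∈-quadruples : ∀ (word : Bool × Bool → Vec Bool 4) pq {p q r s n} →
  p ℕ.< q → q ℕ.< r → r ℕ.< s → s ℕ.< n →
  parity s ∷ parity r ∷ parity q ∷ parity p ∷ [] ≡ word pq →
  s ∷ r ∷ q ∷ p ∷ [] ∈ quadruples word n
∈-quadruples word pq {n = n} p<q q<r r<s s<n eq = ∈-concatMap⁺ (λ p → sequences (word p) n)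
  (Any.map (λ { ≡.refl → ≡.subst (λ bs → _ ∈ sequences bs n) eq (sequences₄-complete p<q q<r r<s s<n) }) (pairs-complete pq))

-- Counting the quadruples.

module Counting where

  open import Data.Nat.Base using (_+_; _*_; _∸_; _≤_; _<_; z≤n; s≤s; ⌊_/2⌋)
  open import Data.Nat.Combinatorics using (_C_; nCn≡1; nC1≡n; nCk≡nC[n∸k]; k>n⇒nCk≡0; nCk+nC[k+1]≡[n+1]C[k+1])
  open ≡ using (refl; sym; trans; cong; cong₂; module ≡-Reasoning)

  double : ℕ → ℕ
  double zero    = zero
  double (suc m) = suc (suc (double m))

  data Halved : ℕ → Set where
    even : ∀ m → Halved (double m)
    odd  : ∀ m → Halved (suc (double m))

  halve : ∀ n → Halved n
  halve zero = even 0
  halve (suc n) with halve n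
  ... | even m = odd m
  ... | odd m  = even (suc m)

  ⌊double/2⌋ : ∀ m → ⌊ double m /2⌋ ≡ m
  ⌊double/2⌋ zero    = refl
  ⌊double/2⌋ (suc m) = cong suc (⌊double/2⌋ m)

  ⌊1+double/2⌋ : ∀ m → ⌊ suc (double m) /2⌋ ≡ m
  ⌊1+double/2⌋ zero    = refl
  ⌊1+double/2⌋ (suc m) = cong suc (⌊1+double/2⌋ m)

  parity-double : ∀ m → parity (double m) ≡ false
  parity-double zero    = refl
  parity-double (suc m) rewrite parity-double m = refl

  -- A range ending with the unpaired number 2m offers one more value exactly when the largest entry
  -- has to be even.
  evenLast : ∀ {k} → Vec Bool k → ℕ
  evenLast []          = 0
  evenLast (false ∷ _) = 1
  evenLast (true ∷ _)  = 0

  -- In pairs {2h, 2h+1}, consecutive entries may share h exactly when they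
  -- are even, then odd; rises counts these places.
  rises : ∀ {k} → Vec Bool k → ℕ
  rises []           = 0
  rises (false ∷ bs) = rises bs
  rises (true ∷ bs)  = evenLast bs + rises bs

  -- Needed for the empty range, where the binomial coefficient has to vanish.
  rises< : ∀ {k} b (bs : Vec Bool k) → rises (b ∷ bs) < suc k
  rises< false []       = s≤s z≤n
  rises< true  []       = s≤s z≤n
  rises< false (b ∷ bs) = ℕ.m≤n⇒m≤1+n (rises< b bs)
  rises< true  (false ∷ bs) = s≤s (rises< false bs)
  rises< true  (true ∷ bs)  = ℕ.m≤n⇒m≤1+n (rises< true bs)

  nC0≡1 : ∀ n → n C 0 ≡ 1
  nC0≡1 n = trans (nCk≡nC[n∸k] {0} {n} z≤n) (nCn≡1 n)

  length-sequences-same : ∀ {k b} (bs : Vec Bool k) n → parity n ≡ b →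
    length (sequences (b ∷ bs) (suc n)) ≡ length (sequences (b ∷ bs) n) + length (sequences bs n)
  length-sequences-same bs n refl = trans (List.length-++ (sequences (parity n ∷ bs) n))
    (cong (length (sequences (parity n ∷ bs) n) +_)
      (trans (cong length (extend-same (parity n) bs n)) (List.length-map (n ∷_) (sequences bs n))))

  length-sequences-different : ∀ {k b} (bs : Vec Bool k) n → b ≡ not (parity n) →
    length (sequences (b ∷ bs) (suc n)) ≡ length (sequences (b ∷ bs) n)
  length-sequences-different bs n refl with parity n
  ... | false = cong length (List.++-identityʳ (sequences (true ∷ bs) n))
  ... | true  = cong length (List.++-identityʳ (sequences (false ∷ bs) n))

  mutual

    -- Halving the entries gives numbers below m that increase strictly except at rises, where they
    -- may agree. Adding to each the number of rises up to it yields an arbitrary k-subset of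
    -- `rises bs + m` numbers. The induction removes the largest number of the range, by Pascal's
    -- rule if its parity fits the largest entry.
    length-sequences-even : ∀ {k} (bs : Vec Bool k) m → length (sequences bs (double m)) ≡ (rises bs + m) C k
    length-sequences-even []       m    = sym (nC0≡1 m)
    length-sequences-even (b ∷ bs) zero = sym (k>n⇒nCk≡0
      (≡.subst (_< _) (sym (ℕ.+-identityʳ (rises (b ∷ bs)))) (rises< b bs)))
    length-sequences-even {suc k} (false ∷ bs) (suc m) = begin
      length (sequences (false ∷ bs) (double (suc m)))
        ≡⟨ length-sequences-different bs (suc (double m)) (cong (λ p → not (not p)) (sym (parity-double m))) ⟩
      length (sequences (false ∷ bs) (suc (double m)))
        ≡⟨ length-sequences-odd (false ∷ bs) m ⟩
      suc (rises bs + m) C suc k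
        ≡⟨ cong (_C suc k) (ℕ.+-suc (rises bs) m) ⟨
      (rises bs + suc m) C suc k ∎
      where
      open ≡-Reasoning
    length-sequences-even {suc k} (true ∷ bs) (suc m) = begin
      length (sequences (true ∷ bs) (double (suc m)))
        ≡⟨ length-sequences-same bs (suc (double m)) (cong not (parity-double m)) ⟩
      length (sequences (true ∷ bs) (suc (double m))) + length (sequences bs (suc (double m)))
        ≡⟨ cong₂ _+_ (length-sequences-odd (true ∷ bs) m) (length-sequences-odd bs m) ⟩
      (r + m) C suc k + (r + m) C k
        ≡⟨ ℕ.+-comm ((r + m) C suc k) _ ⟩
      (r + m) C k + (r + m) C suc k
        ≡⟨ nCk+nC[k+1]≡[n+1]C[k+1] (r + m) k ⟩
      suc (r + m) C suc k
        ≡⟨ cong (_C suc k) (ℕ.+-suc r m) ⟨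
      (r + suc m) C suc k ∎
      where
      open ≡-Reasoning
      r : ℕ
      r = evenLast bs + rises bs

    length-sequences-odd : ∀ {k} (bs : Vec Bool k) m →
                           length (sequences bs (suc (double m))) ≡ (evenLast bs + rises bs + m) C k
    length-sequences-odd [] m = sym (nC0≡1 m)
    length-sequences-odd {suc k} (false ∷ bs) m = begin
      length (sequences (false ∷ bs) (suc (double m)))
        ≡⟨ length-sequences-same bs (double m) (parity-double m) ⟩
      length (sequences (false ∷ bs) (double m)) + length (sequences bs (double m))
        ≡⟨ cong₂ _+_ (length-sequences-even (false ∷ bs) m) (length-sequences-even bs m) ⟩
      (rises bs + m) C suc k + (rises bs + m) C k
        ≡⟨ ℕ.+-comm ((rises bs + m) C suc k) _ ⟩
      (rises bs + m) C k + (rises bs + m) C suc k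
        ≡⟨ nCk+nC[k+1]≡[n+1]C[k+1] (rises bs + m) k ⟩
      suc (rises bs + m) C suc k ∎
      where
      open ≡-Reasoning
    length-sequences-odd {suc k} (true ∷ bs) m =
      trans (length-sequences-different bs (double m) (cong not (sym (parity-double m))))
        (length-sequences-even (true ∷ bs) m)

  length-quadruples : ∀ word n (f : Vec Bool 4 → ℕ) → (∀ bs → length (sequences bs n) ≡ f bs) →
    length (quadruples word n) ≡
    f (word (false , false)) + (f (word (false , true)) + (f (word (true , false)) + f (word (true , true))))
  length-quadruples word n f length-f =
    trans (List.length-++ (s (false , false))) (cong₂ _+_ (length-f _)
      (trans (List.length-++ (s (false , true))) (cong₂ _+_ (length-f _)
        (trans (List.length-++ (s (true , false))) (cong₂ _+_ (length-f _)
          (trans (cong length (List.++-identityʳ (s (true , true)))) (length-f _)))))))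
    where
    s : Bool × Bool → List (Vec ℕ 4)
    s pq = sequences (word pq) n

  crossingQuadruples : ℕ → ℕ
  crossingQuadruples n = length (quadruples separated n) + (length (quadruples alternating n) + length (quadruples nested n))

  -- Of the twelve words, six have no rise and six have one.
  crossingQuadruples-even : ∀ m → crossingQuadruples (double m) ≡ 6 * (m C 4 + suc m C 4)
  crossingQuadruples-even m = trans (cong₂ _+_ (total separated) (cong₂ _+_ (total alternating) (total nested)))
    (solve 2 (λ x y →
      (x :+ (y :+ (x :+ x))) :+ ((y :+ (y :+ (y :+ x))) :+ (x :+ (y :+ (y :+ x)))) := con 6 :* (x :+ y))
      refl (m C 4) (suc m C 4))
    where
    open +-*-Solver
    total = λ word → length-quadruples word (double m) _ (λ bs → length-sequences-even bs m)

  -- Over the twelve words, `evenLast` plus `rises` is 0 twice, 1 eight times and 2 twice.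
  crossingQuadruples-odd : ∀ m → crossingQuadruples (suc (double m)) ≡ 2 * (m C 4 + 4 * (suc m C 4) + suc (suc m) C 4)
  crossingQuadruples-odd m = trans (cong₂ _+_ (total separated) (cong₂ _+_ (total alternating) (total nested)))
    (solve 3 (λ x y z →
      (y :+ (y :+ (y :+ x))) :+ ((y :+ (z :+ (y :+ y))) :+ (y :+ (z :+ (y :+ x)))) := con 2 :* (x :+ con 4 :* y :+ z))
      refl (m C 4) (suc m C 4) (suc (suc m) C 4))
    where
    open +-*-Solver
    total = λ word → length-quadruples word (suc (double m)) _ (λ bs → length-sequences-odd bs m)

  -- Falling factorials, with the argument shifted so that the least factor is j and no truncated
  -- subtraction occurs.
  2*C₂ : ∀ j → 2 * ((1 + j) C 2) ≡ (1 + j) * j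
  2*C₂ zero    = refl
  2*C₂ (suc j) = begin
    2 * ((2 + j) C 2)                          ≡⟨ cong (2 *_) (nCk+nC[k+1]≡[n+1]C[k+1] (1 + j) 1) ⟨
    2 * ((1 + j) C 1 + (1 + j) C 2)            ≡⟨ ℕ.*-distribˡ-+ 2 ((1 + j) C 1) _ ⟩
    2 * ((1 + j) C 1) + 2 * ((1 + j) C 2)      ≡⟨ cong₂ (λ x y → 2 * x + y) (nC1≡n (1 + j)) (2*C₂ j) ⟩
    2 * (1 + j) + (1 + j) * j                  ≡⟨ solve 1 (λ j → con 2 :* (con 1 :+ j) :+ (con 1 :+ j) :* j := (con 2 :+ j) :* (con 1 :+ j)) refl j ⟩
    (2 + j) * (1 + j)                          ∎
    where
    open ≡-Reasoning
    open +-*-Solver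

  6*C₃ : ∀ j → 6 * ((2 + j) C 3) ≡ (2 + j) * ((1 + j) * j)
  6*C₃ zero    = refl
  6*C₃ (suc j) = begin
    6 * ((3 + j) C 3)                          ≡⟨ cong (6 *_) (nCk+nC[k+1]≡[n+1]C[k+1] (2 + j) 2) ⟨
    6 * ((2 + j) C 2 + (2 + j) C 3)            ≡⟨ solve 2 (λ x y → con 6 :* (x :+ y) := con 3 :* (con 2 :* x) :+ con 6 :* y) refl ((2 + j) C 2) ((2 + j) C 3) ⟩
    3 * (2 * ((2 + j) C 2)) + 6 * ((2 + j) C 3)  ≡⟨ cong₂ (λ x y → 3 * x + y) (2*C₂ (suc j)) (6*C₃ j) ⟩
    3 * ((2 + j) * (1 + j)) + (2 + j) * ((1 + j) * j)
      ≡⟨ solve 1 (λ j → con 3 :* ((con 2 :+ j) :* (con 1 :+ j)) :+ (con 2 :+ j) :* ((con 1 :+ j) :* j) := (con 3 :+ j) :* ((con 2 :+ j) :* (con 1 :+ j))) refl j ⟩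
    (3 + j) * ((2 + j) * (1 + j))              ∎
    where
    open ≡-Reasoning
    open +-*-Solver

  24*C₄ : ∀ j → 24 * ((3 + j) C 4) ≡ (3 + j) * ((2 + j) * ((1 + j) * j))
  24*C₄ zero    = refl
  24*C₄ (suc j) = begin
    24 * ((4 + j) C 4)                         ≡⟨ cong (24 *_) (nCk+nC[k+1]≡[n+1]C[k+1] (3 + j) 3) ⟨
    24 * ((3 + j) C 3 + (3 + j) C 4)           ≡⟨ solve 2 (λ x y → con 24 :* (x :+ y) := con 4 :* (con 6 :* x) :+ con 24 :* y) refl ((3 + j) C 3) ((3 + j) C 4) ⟩
    4 * (6 * ((3 + j) C 3)) + 24 * ((3 + j) C 4) ≡⟨ cong₂ (λ x y → 4 * x + y) (6*C₃ (suc j)) (24*C₄ j) ⟩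
    4 * ((3 + j) * ((2 + j) * (1 + j))) + (3 + j) * ((2 + j) * ((1 + j) * j))
      ≡⟨ solve 1 (λ j → con 4 :* ((con 3 :+ j) :* ((con 2 :+ j) :* (con 1 :+ j))) :+ (con 3 :+ j) :* ((con 2 :+ j) :* ((con 1 :+ j) :* j)) := (con 4 :+ j) :* ((con 3 :+ j) :* ((con 2 :+ j) :* (con 1 :+ j)))) refl j ⟩
    (4 + j) * ((3 + j) * ((2 + j) * (1 + j)))  ∎
    where
    open ≡-Reasoning
    open +-*-Solver

  bound : ℕ → ℕ
  bound n = ⌊ n /2⌋ * ⌊ n ∸ 1 /2⌋ * ⌊ n ∸ 2 /2⌋ * ⌊ n ∸ 3 /2⌋

  2*crossingQuadruples : ∀ n → 2 * crossingQuadruples n ≡ bound n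
  2*crossingQuadruples n with halve n
  -- The shifted formula `24*C₄` starts at m = 3; below that, both sides are evaluated.
  ... | even 0 = refl
  ... | even 1 = refl
  ... | even 2 = refl
  ... | odd 0  = refl
  ... | odd 1  = refl
  ... | odd 2  = refl
  ... | even m@(suc (suc (suc j))) = begin
    2 * crossingQuadruples (double m)   ≡⟨ cong (2 *_) (crossingQuadruples-even m) ⟩
    -- The extra factor 2 completes 12 to the 24 of `24*C₄`; in the odd case 6 completes 4.
    2 * (6 * (m C 4 + suc m C 4))       ≡⟨ ℕ.*-cancelˡ-≡ _ _ 2 (begin
      2 * (2 * (6 * (m C 4 + suc m C 4)))
        ≡⟨ solve 2 (λ x y → con 2 :* (con 2 :* (con 6 :* (x :+ y))) := con 24 :* x :+ con 24 :* y) refl (m C 4) (suc m C 4) ⟩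
      24 * (m C 4) + 24 * (suc m C 4)
        ≡⟨ cong₂ _+_ (24*C₄ j) (24*C₄ (suc j)) ⟩
      (3 + j) * ((2 + j) * ((1 + j) * j)) + (4 + j) * ((3 + j) * ((2 + j) * (1 + j)))
        ≡⟨ solve 1 (λ j → (con 3 :+ j) :* ((con 2 :+ j) :* ((con 1 :+ j) :* j)) :+ (con 4 :+ j) :* ((con 3 :+ j) :* ((con 2 :+ j) :* (con 1 :+ j)))
             := con 2 :* ((con 3 :+ j) :* (con 2 :+ j) :* (con 2 :+ j) :* (con 1 :+ j))) refl j ⟩
      2 * (m * (2 + j) * (2 + j) * (1 + j)) ∎) ⟩
    m * (2 + j) * (2 + j) * (1 + j)
      ≡⟨ cong₂ (λ x y → (3 + x) * (2 + y) * (2 + x) * (1 + y)) (⌊double/2⌋ j) (⌊1+double/2⌋ j) ⟨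
    bound (double m) ∎
    where
    open ≡-Reasoning
    open +-*-Solver
  ... | odd m@(suc (suc (suc j))) = begin
    2 * crossingQuadruples (suc (double m))   ≡⟨ cong (2 *_) (crossingQuadruples-odd m) ⟩
    2 * (2 * (m C 4 + 4 * (suc m C 4) + suc (suc m) C 4))       ≡⟨ ℕ.*-cancelˡ-≡ _ _ 6 (begin
      6 * (2 * (2 * (m C 4 + 4 * (suc m C 4) + suc (suc m) C 4)))
        ≡⟨ solve 3 (λ x y z → con 6 :* (con 2 :* (con 2 :* (x :+ con 4 :* y :+ z))) := con 24 :* x :+ con 4 :* (con 24 :* y) :+ con 24 :* z)
             refl (m C 4) (suc m C 4) (suc (suc m) C 4) ⟩
      24 * (m C 4) + 4 * (24 * (suc m C 4)) + 24 * (suc (suc m) C 4)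
        ≡⟨ cong₂ _+_ (cong₂ (λ x y → x + 4 * y) (24*C₄ j) (24*C₄ (suc j))) (24*C₄ (suc (suc j))) ⟩
      (3 + j) * ((2 + j) * ((1 + j) * j)) + 4 * ((4 + j) * ((3 + j) * ((2 + j) * (1 + j)))) + (5 + j) * ((4 + j) * ((3 + j) * (2 + j)))
        ≡⟨ solve 1 (λ j → (con 3 :+ j) :* ((con 2 :+ j) :* ((con 1 :+ j) :* j)) :+ con 4 :* ((con 4 :+ j) :* ((con 3 :+ j) :* ((con 2 :+ j) :* (con 1 :+ j))))
                          :+ (con 5 :+ j) :* ((con 4 :+ j) :* ((con 3 :+ j) :* (con 2 :+ j)))
             := con 6 :* ((con 3 :+ j) :* (con 3 :+ j) :* (con 2 :+ j) :* (con 2 :+ j))) refl j ⟩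
      6 * (m * m * (2 + j) * (2 + j)) ∎) ⟩
    m * m * (2 + j) * (2 + j)
      ≡⟨ cong₂ (λ x y → (3 + y) * (3 + x) * (2 + y) * (2 + x)) (⌊double/2⌋ j) (⌊1+double/2⌋ j) ⟨
    bound (suc (double m)) ∎
    where
    open ≡-Reasoning
    open +-*-Solver

-- The crossings of the drawing.

module CrownCrossings (ℝ : CompleteOrderedField) (m : ℕ) where

  n : ℕ
  n = suc m

  open OrderedField ℝ
  open CentralProjection ℝ
  open Signs ℝ
  open CrownDrawing ℝ n
  open Graph G using (V; _~_; ~-sym)
  open import Relation.Binary.Reasoning.Setoid setoid

  infix 4 _≈ᵖ_
  _≈ᵖ_ : Point ℝ → Point ℝ → Set
  _≈ᵖ_ = _≈ᴾ_ ℝ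

  module Plane = Setoid (planeSetoid ℝ)

  arc : V → V → Carrier → Point ℝ
  arc = Drawing.arc drawing

  arc-cong : ∀ u v {s t} → s ≈ t → arc u v s ≈ᵖ arc u v t
  arc-cong u v e = project-cong (curve-cong u v e)

  arc-backwards : ∀ u v s → arc v u (1# - s) ≈ᵖ arc u v s
  arc-backwards u v s = Plane.trans (project-cong (curve-reverse u v (1# - s)))
    (arc-cong u v (solve 1 (λ s → :1 :- (:1 :- s) := s) refl s))

  X : Set
  X = Crossing ℝ drawing

  X-setoid : Setoid 0ℓ 0ℓ
  X-setoid = crossingSetoid ℝ drawing

  open Setoid X-setoid using () renaming (_≈_ to _≈ˣ_; sym to ≈ˣ-sym; trans to ≈ˣ-trans)
  open Setoid (edgeSetoid G) using () renaming (_≈_ to _≈ᴱ_; refl to ≈ᴱ-refl)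

  flip-open : ∀ {s} → OpenUnit ℝ s → OpenUnit ℝ (1# - s)
  flip-open {s} (0<s , s<1) = <⇒Pos s<1 , Pos⇒< (Pos-resp (solve 1 (λ s → s := :1 :- (:1 :- s)) refl s) 0<s)

  -- The changes of presentation that leave a crossing the same; they transport statements about u
  -- and w to the other ends and lead to a `Canonical` presentation.
  reverseˡ reverseʳ exchange : X → X
  reverseˡ c = record
    { u~v = ~-sym u~v ; w~z = w~z
    ; distinct = λ e → distinct (Sum.map swap swap (Sum.swap e))
    ; s∈ = flip-open s∈ ; t∈ = t∈
    ; meet = Plane.trans (arc-backwards u v s) meet
    }
    where
    open Crossing c
  reverseʳ c = record
    { u~v = u~v ; w~z = ~-sym w~z
    ; distinct = λ e → distinct (Sum.swap e)
    ; s∈ = s∈ ; t∈ = flip-open t∈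
    ; meet = Plane.trans meet (Plane.sym (arc-backwards w z t))
    }
    where
    open Crossing c
  exchange c = record
    { u~v = w~z ; w~z = u~v
    ; distinct = λ e → distinct (Setoid.sym (edgeSetoid G) e)
    ; s∈ = t∈ ; t∈ = s∈ ; meet = Plane.sym meet
    }
    where
    open Crossing c

  reverseˡ-≈ : ∀ c → c ≈ˣ reverseˡ c
  reverseˡ-≈ c = Plane.sym (arc-backwards u v s) , inj₁ (inj₂ (≡.refl , ≡.refl) , ≈ᴱ-refl)
    where
    open Crossing c

  reverseʳ-≈ : ∀ c → c ≈ˣ reverseʳ c
  reverseʳ-≈ c = Plane.refl , inj₁ (≈ᴱ-refl , inj₂ (≡.refl , ≡.refl))

  exchange-≈ : ∀ c → c ≈ˣ exchange c
  exchange-≈ c = Crossing.meet c , inj₂ (≈ᴱ-refl , ≈ᴱ-refl)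

  parallel : ∀ (c : X) → let open Crossing c in Parallel (curve u v s) (curve w z t)
  parallel c = project-injective (curve-radius u v u~v s) (curve-radius w z w~z t) meet
    where
    open Crossing c

  -- If v and z also share an index, comparing coefficients shows that orientations agree, so the
  -- edges coincide. Otherwise the quadratic vanishing at u and v vanishes at w too, but not at z.
  index-distinctˡ : ∀ (c : X) → let open Crossing c in proj₁ u ≢ proj₁ w
  index-distinctˡ c i≡j with proj₁ (Crossing.v c) Fin.≟ proj₁ (Crossing.z c)
  ... | yes k≡l = distinct (inj₁ (u≡w , v≡z))
    where
    open Crossing c
    aligned : Parallel (curve u v s) (combine ((1# - t) * weight w) (time u) (t * weight z) (time v))
    aligned = Parallel-resp (refl , refl , refl)
      (combine-cong refl (reflexive (≡.cong (ι ∘ toℕ) (≡.sym i≡j))) refl (reflexive (≡.cong (ι ∘ toℕ) (≡.sym k≡l)))) (parallel c)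
    open Parallel aligned
    u≡w : u ≡ w
    u≡w = vertex-unique u w (≡.cong toℕ i≡j) (orientation-unique u w λ>0 μ>0
      (<⇒Pos (proj₂ s∈)) (<⇒Pos (proj₂ t∈)) (coefficientˡ (difference-nonzero u v (proj₁ u~v)) aligned))
    v≡z : v ≡ z
    v≡z = vertex-unique v z (≡.cong toℕ k≡l) (orientation-unique v z λ>0 μ>0
      (proj₁ s∈) (proj₁ t∈) (coefficientʳ (difference-nonzero v u (≡.≢-sym (proj₁ u~v))) aligned))
  ... | no k≢l = *-nonzero (*-nonzero (*-nonzero (¬Pos-0 (proj₁ t∈)) (weight-nonzero z))
      (*-nonzero (difference-nonzero z u (λ l≡i → proj₁ w~z (≡.sym (≡.trans l≡i i≡j)))) (difference-nonzero z v (≡.≢-sym k≢l)))) (¬Pos-0 μ>0) (begin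
      t * weight z * ((d - a) * (d - b)) * μ′
        ≈⟨ solve 6 (λ C D a d b m → D :* ((d :- a) :* (d :- b)) :* m := (C :* ((a :- a) :* (a :- b)) :+ D :* ((d :- a) :* (d :- b))) :* m) refl ((1# - t) * weight w) (t * weight z) a d b μ′ ⟩
      ((1# - t) * weight w * ((a - a) * (a - b)) + t * weight z * ((d - a) * (d - b))) * μ′
        ≡⟨ ≡.cong (λ i → ((1# - t) * weight w * ((ι (toℕ i) - a) * (ι (toℕ i) - b)) + t * weight z * ((d - a) * (d - b))) * μ′) i≡j ⟩
      ((1# - t) * weight w * ((time w - a) * (time w - b)) + t * weight z * ((d - a) * (d - b))) * μ′
        ≈⟨ quadratic-functional (parallel c) a b ⟨
      ((1# - s) * weight u * ((a - a) * (a - b)) + s * weight v * ((b - a) * (b - b))) * λ′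
        ≈⟨ solve 5 (λ A B a b l → (A :* ((a :- a) :* (a :- b)) :+ B :* ((b :- a) :* (b :- b))) :* l := :0) refl ((1# - s) * weight u) (s * weight v) a b λ′ ⟩
      0# ∎)
    where
    open Crossing c
    open Parallel (parallel c)
    a = time u
    b = time v
    d = time z

  -- The functional vanishing at the ends of the second edge determines
  -- the point of the first edge where the two edges cross.
  parameter : V → V → V → V → Carrier
  parameter u v w z = α * inv (α - β)
    where
    α = weight u * ((time u - time w) * (time u - time z))
    β = weight v * ((time v - time w) * (time v - time z))

  -- The functional yields (1 - s)α + sβ = 0, that is s(α - β) = α. Since u shares no index with w
  -- or z, α is nonzero, hence so is α - β.
  parameter-unique : ∀ (c : X) → let open Crossing c in s ≈ parameter u v w z
  parameter-unique c = *-cancelʳ α-β≉0 (trans s[α-β] (sym (trans (*-assoc α _ _)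
    (trans (*-congˡ (trans (*-comm _ _) (inv-inverse α-β≉0))) (*-identityʳ α)))))
    where
    open Crossing c
    open Parallel (parallel c)
    a = time u
    b = time v
    α = weight u * ((a - time w) * (a - time z))
    β = weight v * ((b - time w) * (b - time z))
    α≉0 : ¬ α ≈ 0#
    α≉0 = *-nonzero (weight-nonzero u) (*-nonzero
      (difference-nonzero u w (index-distinctˡ c)) (difference-nonzero u z (index-distinctˡ (reverseʳ c))))
    balance : (1# - s) * α + s * β ≈ 0#
    balance = *-cancelʳ (¬Pos-0 λ>0) (begin
      ((1# - s) * α + s * β) * λ′
        ≈⟨ solve 6 (λ s e p f q l → ((:1 :- s) :* (e :* p) :+ s :* (f :* q)) :* l := ((:1 :- s) :* e :* p :+ s :* f :* q) :* l)
             refl s (weight u) ((a - time w) * (a - time z)) (weight v) ((b - time w) * (b - time z)) λ′ ⟩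
      ((1# - s) * weight u * ((a - time w) * (a - time z)) + s * weight v * ((b - time w) * (b - time z))) * λ′
        ≈⟨ quadratic-functional (parallel c) (time w) (time z) ⟩
      ((1# - t) * weight w * ((time w - time w) * (time w - time z)) + t * weight z * ((time z - time w) * (time z - time z))) * μ′
        ≈⟨ solve 6 (λ C D c d m l → (C :* ((c :- c) :* (c :- d)) :+ D :* ((d :- c) :* (d :- d))) :* m := :0 :* l)
             refl ((1# - t) * weight w) (t * weight z) (time w) (time z) μ′ λ′ ⟩
      0# * λ′ ∎)
    s[α-β] : s * (α - β) ≈ α
    s[α-β] = begin
      s * (α - β)                          ≈⟨ solve 3 (λ s α β → s :* (α :- β) := α :- ((:1 :- s) :* α :+ s :* β)) refl s α β ⟩
      α - ((1# - s) * α + s * β)           ≈⟨ +-congˡ (-‿cong balance) ⟩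
      α - 0#                               ≈⟨ solve 1 (λ α → α :- :0 := α) refl α ⟩
      α                                    ∎
    α-β≉0 : ¬ α - β ≈ 0#
    α-β≉0 e = α≉0 (trans (sym s[α-β]) (trans (*-congˡ e) (zeroʳ s)))

  _≟ⱽ_ : Decidable {A = V} _≡_
  _≟ⱽ_ = ≡-dec Fin._≟_ Fin._≟_

  _≟ᴱ_ : Decidable _≈ᴱ_
  _≟ᴱ_ = unorderedPair-decidable (≡.setoid V) _≟ⱽ_

  _≟ᵖ_ : Decidable _≈ᵖ_
  (x , y) ≟ᵖ (x′ , y′) = (x ≟ x′) ×-dec (y ≟ y′)

  X-decSetoid : DecSetoid 0ℓ 0ℓ
  X-decSetoid = record
    { isDecEquivalence = record
      { isEquivalence = Setoid.isEquivalence X-setoid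
      ; _≟_ = λ c d → (Crossing.place c ≟ᵖ Crossing.place d) ×-dec
                      unorderedPair-decidable (edgeSetoid G) _≟ᴱ_ (Crossing.edges c) (Crossing.edges d)
      }
    }

  -- A crossing at the only parameters possible: no quantifier over reals remains, so this is
  -- decidable.
  Cross : V → V → V → V → Set
  Cross u v w z = u ~ v × w ~ z × ¬ ((u , v) ≈ᴱ (w , z)) ×
    OpenUnit ℝ (parameter u v w z) × OpenUnit ℝ (parameter w z u v) ×
    arc u v (parameter u v w z) ≈ᵖ arc w z (parameter w z u v)

  abstract

    cross? : ∀ u v w z → Dec (Cross u v w z)
    cross? u v w z = u ~? v ×-dec w ~? z ×-dec ¬? ((u , v) ≟ᴱ (w , z)) ×-dec
      open? _ ×-dec open? _ ×-dec (_ ≟ᵖ _)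
      where
      _~?_ : Decidable _~_
      (i , x) ~? (j , y) = ¬? (i Fin.≟ j) ×-dec ((suc (toℕ x) ℕ.≟ toℕ y) ⊎-dec (suc (toℕ y) ℕ.≟ toℕ x))
      open? : ∀ s → Dec (OpenUnit ℝ s)
      open? s = (0# <? s) ×-dec (s <? 1#)

  crossing : ∀ {u v w z} → Cross u v w z → X
  crossing (u~v , w~z , distinct , s∈ , t∈ , meet) = record
    { u~v = u~v ; w~z = w~z ; distinct = distinct ; s∈ = s∈ ; t∈ = t∈ ; meet = meet }

  Code : Set
  Code = V × V × V × V

  decided : ∀ {u v w z} → Dec (Cross u v w z) → Maybe X
  decided (yes cross) = just (crossing cross)
  decided (no _)      = nothing

  -- A code failing the test contributes nothing, which is harmless for an upper bound.
  candidate : Code → Maybe X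
  candidate (u , v , w , z) = decided (cross? u v w z)

  code : X → Code
  code c = u , v , w , z
    where
    open Crossing c

  cross : ∀ (c : X) → let open Crossing c in Cross u v w z
  cross c = u~v , w~z , distinct , move s≈ s∈ , move t≈ t∈ ,
    Plane.trans (arc-cong u v (sym s≈)) (Plane.trans meet (arc-cong w z t≈))
    where
    open Crossing c
    s≈ : s ≈ parameter u v w z
    s≈ = parameter-unique c
    t≈ : t ≈ parameter w z u v
    t≈ = parameter-unique (exchange c)
    move : ∀ {a b} → a ≈ b → OpenUnit ℝ a → OpenUnit ℝ b
    move e (p , q) = Pos-resp e p , <-respˡ e q

  crossing-≈ : ∀ (c : X) (p : Cross (Crossing.u c) (Crossing.v c) (Crossing.w c) (Crossing.z c)) → c ≈ˣ crossing p
  crossing-≈ c p = arc-cong u v {s} {parameter u v w z} (parameter-unique c) , inj₁ (≈ᴱ-refl , ≈ᴱ-refl)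
    where
    open Crossing c

  candidate-complete : ∀ c → MaybeAny.Any (c ≈ˣ_) (candidate (code c))
  candidate-complete c = complete (cross? u v w z)
    where
    open Crossing c
    complete : ∀ d → MaybeAny.Any (c ≈ˣ_) (decided d)
    complete (yes p) = MaybeAny.just (crossing-≈ c p)
    complete (no ¬p) = ⊥-elim (¬p (cross c))

  -- Which edges cross

  -- Reduction modulo n makes the decoding total, so that codes can be formed from bare sequences;
  -- it fixes the indices below n.
  vertex : ℕ → Bool → V
  vertex k o = fromℕ< (m%n<n k n) , colour (parity k xor o)

  vertex≡ : ∀ v {o} → orientation v ≡ o → v ≡ vertex (index v) o
  vertex≡ v@(i , x) ≡.refl = ≡.cong₂ _,_
    (≡.sym (Fin.toℕ-injective (≡.trans (Fin.toℕ-fromℕ< _) (m<n⇒m%n≡m (Fin.toℕ<n i)))))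
    (≡.sym (≡.trans (≡.cong colour (≡.sym (bit≡ v))) (colour-bit x)))

  -- Moving the second edge to the other side turns a crossing into a linear dependency, whose signs
  -- alternate with increasing index. So the orientation o at the least index p determines the other
  -- three.
  separate interleave nest : Bool → Vec ℕ 4 → Code
  separate   o (s ∷ r ∷ q ∷ p ∷ []) = vertex p o , vertex q (not o) , vertex r (not o) , vertex s o
  interleave o (s ∷ r ∷ q ∷ p ∷ []) = vertex p o , vertex r o , vertex q o , vertex s o
  nest       o (s ∷ r ∷ q ∷ p ∷ []) = vertex p o , vertex s (not o) , vertex q o , vertex r (not o)

  module _ {A a B b C c D d : Carrier} {α γ : Bool} (par : Parallel (combine A a B b) (combine C c D d))
           (A± : Signed α A) (C± : Signed γ C) where

    open Parallel par

    -- The functional vanishing at b and d compares the coefficients of a and c.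
    across-sign : ∀ {ab ad cb cd} → Signed ab (a - b) → Signed ad (a - d) → Signed cb (c - b) → Signed cd (c - d) →
                  (ab xor ad) xor α ≡ (cb xor cd) xor γ
    across-sign ab± ad± cb± cd± = Signed-unique
      (Signed-* (Signed-* ab± ad±) (Signed-*ʳ A± λ>0))
      (Signed-resp (begin
        (c - b) * (c - d) * (C * μ′)
          ≈⟨ solve 6 (λ C c D b d m → (c :- b) :* (c :- d) :* (C :* m) := (C :* ((c :- b) :* (c :- d)) :+ D :* ((d :- b) :* (d :- d))) :* m) refl C c D b d μ′ ⟩
        (C * ((c - b) * (c - d)) + D * ((d - b) * (d - d))) * μ′
          ≈⟨ quadratic-functional par b d ⟨
        (A * ((a - b) * (a - d)) + B * ((b - b) * (b - d))) * λ′
          ≈⟨ solve 6 (λ A a B b d l → (a :- b) :* (a :- d) :* (A :* l) := (A :* ((a :- b) :* (a :- d)) :+ B :* ((b :- b) :* (b :- d))) :* l) refl A a B b d λ′ ⟨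
        (a - b) * (a - d) * (A * λ′) ∎)
      (Signed-* (Signed-* cb± cd±) (Signed-*ʳ C± μ>0)))

  -- The functional vanishing at c and d compares the coefficients of a and b.
  along-sign : ∀ {A a B b C c D d α β ac ad bc bd} → Parallel (combine A a B b) (combine C c D d) →
               Signed α A → Signed β B →
               Signed ac (a - c) → Signed ad (a - d) → Signed bc (b - c) → Signed bd (b - d) →
               (ac xor ad) xor α ≡ not ((bc xor bd) xor β)
  along-sign {A} {a} {B} {b} {C} {c} {D} {d} par A± B± ac± ad± bc± bd± = Signed-unique
    (Signed-* (Signed-* ac± ad±) A±)
    (Signed-resp (begin
      - ((b - c) * (b - d) * B)
        ≈⟨ solve 2 (λ p q → :- q := p :- (p :+ q)) refl ((a - c) * (a - d) * A) ((b - c) * (b - d) * B) ⟩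
      (a - c) * (a - d) * A - ((a - c) * (a - d) * A + (b - c) * (b - d) * B)
        ≈⟨ +-congˡ (-‿cong (*-cancelʳ (¬Pos-0 λ>0) vanish)) ⟩
      (a - c) * (a - d) * A - 0#
        ≈⟨ solve 1 (λ p → p :- :0 := p) refl ((a - c) * (a - d) * A) ⟩
      (a - c) * (a - d) * A ∎)
    (Signed-neg (Signed-* (Signed-* bc± bd±) B±)))
    where
    open Parallel par
    vanish : ((a - c) * (a - d) * A + (b - c) * (b - d) * B) * λ′ ≈ 0# * λ′
    vanish = begin
      ((a - c) * (a - d) * A + (b - c) * (b - d) * B) * λ′
        ≈⟨ *-congʳ (+-cong (*-comm _ _) (*-comm _ _)) ⟩
      (A * ((a - c) * (a - d)) + B * ((b - c) * (b - d))) * λ′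
        ≈⟨ quadratic-functional par c d ⟩
      (C * ((c - c) * (c - d)) + D * ((d - c) * (d - d))) * μ′
        ≈⟨ solve 6 (λ C c D d m l → (C :* ((c :- c) :* (c :- d)) :+ D :* ((d :- c) :* (d :- d))) :* m := :0 :* l) refl C c D d μ′ λ′ ⟩
      0# * λ′ ∎

  -- Of the eight presentations of a crossing, the one with both edges increasing and the least
  -- index at u.
  record Canonical (c : X) : Set where
    open Crossing c
    field
      u<v : index u ℕ.< index v
      w<z : index w ℕ.< index z
      u<w : index u ℕ.< index w

  -- The antipodal map exchanges the families of the two values of o.
  family : Bool → List Code
  family o = map (separate o) (quadruples separated n) ++
    map (interleave o) (quadruples alternating n) ++ map (nest o) (quadruples nested n)

  codes : List Code
  codes = family false ++ family true

  abstract

    crossings : List X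
    crossings = mapMaybe candidate codes

    length-crossings : length crossings ℕ.≤ length codes
    length-crossings = List.length-mapMaybe candidate codes

    ∈-crossings : ∀ c → code c ∈ codes → Any (c ≈ˣ_) crossings
    ∈-crossings c c∈ = Any.mapMaybe⁺ candidate codes (Any.map⁺
      (Any.map (λ { ≡.refl → candidate-complete c }) c∈))

  ∈-codes : ∀ o {c} → c ∈ family o → c ∈ codes
  ∈-codes false = ∈-++⁺ˡ
  ∈-codes true  = ∈-++⁺ʳ (family false)

  -- For an edge, x and y are the parities of the indices, a and b the orientations, and the two
  -- `xor`s are the vertices of `P 2`, which differ.
  same-orientation : ∀ x y {a b} → b ≡ a → x xor a ≢ y xor b → y ≡ not x
  same-orientation false false ≡.refl ≢ = ⊥-elim (≢ ≡.refl)
  same-orientation false true  ≡.refl ≢ = ≡.refl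
  same-orientation true  false ≡.refl ≢ = ≡.refl
  same-orientation true  true  ≡.refl ≢ = ⊥-elim (≢ ≡.refl)

  opposite-orientation : ∀ x y {a b} → b ≡ not a → x xor a ≢ y xor b → y ≡ x
  opposite-orientation false false       ≡.refl ≢ = ≡.refl
  opposite-orientation false true  {a}   ≡.refl ≢ = ⊥-elim (≢ (≡.sym (not-involutive a)))
  opposite-orientation true  false       ≡.refl ≢ = ⊥-elim (≢ ≡.refl)
  opposite-orientation true  true        ≡.refl ≢ = ≡.refl

  flip-not : ∀ {x y} → x ≡ not y → y ≡ not x
  flip-not {y = y} ≡.refl = ≡.sym (not-involutive y)

  edge-parity : ∀ {u v} → u ~ v → parity (index u) xor orientation u ≢ parity (index v) xor orientation v
  edge-parity {u} {v} (_ , x~y) e = bit-≢ x~y (≡.trans (bit≡ u) (≡.trans e (≡.sym (bit≡ v))))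

  module _ (c : X) (canonical : Canonical c) where

    open Crossing c
    open Canonical canonical

    private
      o  = orientation u
      pu = parity (index u)
      pv = parity (index v)
      pw = parity (index w)
      pz = parity (index z)

      par : Parallel (curve u v s) (curve w z t)
      par = parallel c
      -- Listing the second edge from its other end lets `across-sign` compare u with z.
      par′ : Parallel (curve u v s) (combine (t * weight z) (time z) ((1# - t) * weight w) (time w))
      par′ = Parallel-resp (refl , refl , refl) (combine-swap ((1# - t) * weight w) (time w) (t * weight z) (time z)) par

      A± : Signed o ((1# - s) * weight u)
      A± = signed-weight u (<⇒Pos (proj₂ s∈))
      B± : Signed (orientation v) (s * weight v)
      B± = signed-weight v (proj₁ s∈)
      C± : Signed (orientation w) ((1# - t) * weight w)
      C± = signed-weight w (<⇒Pos (proj₂ t∈))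
      D± : Signed (orientation z) (t * weight z)
      D± = signed-weight z (proj₁ t∈)

      u<z : index u ℕ.< index z
      u<z = ℕ.<-trans u<w w<z

      z<n : index z ℕ.< n
      z<n = Fin.toℕ<n (proj₁ z)
      v<n : index v ℕ.< n
      v<n = Fin.toℕ<n (proj₁ v)

    separate-∈ : index v ℕ.< index w → code c ∈ codes
    separate-∈ v<w = ∈-codes o (∈-++⁺ˡ (≡.subst (_∈ map (separate o) (quadruples separated n)) (≡.sym code≡)
      (∈-map⁺ (separate o) (∈-quadruples separated (pu , pw) u<v v<w w<z z<n words))))
      where
      v<z = ℕ.<-trans v<w w<z
      w± : orientation w ≡ not o
      -- The quadratic vanishing at v and z is positive at u and negative at w, so u and w have
      -- opposite orientations; the other signs are found alike.
      w± = flip-not (across-sign par A± C± (earlier u<v) (earlier u<z) (later v<w) (earlier w<z))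
      z± : orientation z ≡ o
      z± = ≡.sym (across-sign par′ A± D± (earlier u<v) (earlier u<w) (later v<z) (later w<z))
      v± : orientation v ≡ not o
      v± = flip-not (along-sign par A± B± (earlier u<w) (earlier u<z) (earlier v<w) (earlier v<z))
      code≡ : code c ≡ separate o (index z ∷ index w ∷ index v ∷ index u ∷ [])
      code≡ = ≡.cong₂ _,_ (vertex≡ u ≡.refl) (≡.cong₂ _,_ (vertex≡ v v±) (≡.cong₂ _,_ (vertex≡ w w±) (vertex≡ z z±)))
      words : pz ∷ pw ∷ pv ∷ pu ∷ [] ≡ separated (pu , pw)
      words = ≡.cong₂ (λ a b → a ∷ pw ∷ b ∷ pu ∷ [])
        (opposite-orientation pw pz (≡.trans z± (flip-not w±)) (edge-parity w~z))
        (opposite-orientation pu pv v± (edge-parity u~v))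

    interleave-∈ : index w ℕ.< index v → index v ℕ.< index z → code c ∈ codes
    interleave-∈ w<v v<z = ∈-codes o (∈-++⁺ʳ (map (separate o) (quadruples separated n)) (∈-++⁺ˡ
      (≡.subst (_∈ map (interleave o) (quadruples alternating n)) (≡.sym code≡)
        (∈-map⁺ (interleave o) (∈-quadruples alternating (pu , pw) u<w w<v v<z z<n words)))))
      where
      w± : orientation w ≡ o
      w± = ≡.sym (across-sign par A± C± (earlier u<v) (earlier u<z) (earlier w<v) (earlier w<z))
      z± : orientation z ≡ o
      z± = ≡.sym (across-sign par′ A± D± (earlier u<v) (earlier u<w) (later v<z) (later w<z))
      v± : orientation v ≡ o
      v± = ≡.sym (≡.trans (along-sign par A± B± (earlier u<w) (earlier u<z) (later w<v) (earlier v<z)) (not-involutive _))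
      code≡ : code c ≡ interleave o (index z ∷ index v ∷ index w ∷ index u ∷ [])
      code≡ = ≡.cong₂ _,_ (vertex≡ u ≡.refl) (≡.cong₂ _,_ (vertex≡ v v±) (≡.cong₂ _,_ (vertex≡ w w±) (vertex≡ z z±)))
      words : pz ∷ pv ∷ pw ∷ pu ∷ [] ≡ alternating (pu , pw)
      words = ≡.cong₂ (λ a b → a ∷ b ∷ pw ∷ pu ∷ [])
        (same-orientation pw pz (≡.trans z± (≡.sym w±)) (edge-parity w~z))
        (same-orientation pu pv v± (edge-parity u~v))

    nest-∈ : index z ℕ.< index v → code c ∈ codes
    nest-∈ z<v = ∈-codes o (∈-++⁺ʳ (map (separate o) (quadruples separated n)) (∈-++⁺ʳ (map (interleave o) (quadruples alternating n))
      (≡.subst (_∈ map (nest o) (quadruples nested n)) (≡.sym code≡)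
        (∈-map⁺ (nest o) (∈-quadruples nested (pu , pw) u<w w<z z<v v<n words)))))
      where
      w<v = ℕ.<-trans w<z z<v
      w± : orientation w ≡ o
      w± = ≡.sym (across-sign par A± C± (earlier u<v) (earlier u<z) (earlier w<v) (earlier w<z))
      z± : orientation z ≡ not o
      z± = flip-not (across-sign par′ A± D± (earlier u<v) (earlier u<w) (earlier z<v) (later w<z))
      v± : orientation v ≡ not o
      v± = flip-not (along-sign par A± B± (earlier u<w) (earlier u<z) (later w<v) (later z<v))
      code≡ : code c ≡ nest o (index v ∷ index z ∷ index w ∷ index u ∷ [])
      code≡ = ≡.cong₂ _,_ (vertex≡ u ≡.refl) (≡.cong₂ _,_ (vertex≡ v v±) (≡.cong₂ _,_ (vertex≡ w w±) (vertex≡ z z±)))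
      words : pv ∷ pz ∷ pw ∷ pu ∷ [] ≡ nested (pu , pw)
      words = ≡.cong₂ (λ a b → a ∷ b ∷ pw ∷ pu ∷ [])
        (opposite-orientation pu pv v± (edge-parity u~v))
        (opposite-orientation pw pz (≡.trans z± (≡.cong not (≡.sym w±))) (edge-parity w~z))

    canonical-∈ : code c ∈ codes
    canonical-∈ with ℕ.<-cmp (index v) (index w)
    ... | tri< v<w _ _ = separate-∈ v<w
    -- Reversing the first edge puts v in the position of u.
    ... | tri≈ _ v≡w _ = ⊥-elim (index-distinctˡ (reverseˡ c) (Fin.toℕ-injective v≡w))
    ... | tri> _ _ w<v with ℕ.<-cmp (index v) (index z)
    ...   | tri< v<z _ _ = interleave-∈ w<v v<z
    ...   | tri≈ _ v≡z _ = ⊥-elim (index-distinctˡ (reverseˡ (reverseʳ c)) (Fin.toℕ-injective v≡z))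
    ...   | tri> _ _ z<v = nest-∈ z<v

  -- A wrapper that keeps the list of crossings from being unfolded.
  record Listed (c : X) : Set where
    constructor found
    field position : Any (c ≈ˣ_) crossings

  Listed-resp : ∀ {c d} → c ≈ˣ d → Listed d → Listed c
  Listed-resp {c} {d} c≈d (found i) = found (Any.map (λ {e} d≈e → ≈ˣ-trans {c} {d} {e} c≈d d≈e) i)

  canonical-listed : ∀ c → Canonical c → Listed c
  canonical-listed c canonical = found (∈-crossings c (canonical-∈ c canonical))

  both-increasing-listed : ∀ (c : X) → index (Crossing.u c) ℕ.< index (Crossing.v c) →
                           index (Crossing.w c) ℕ.< index (Crossing.z c) → Listed c
  both-increasing-listed c u<v w<z with ℕ.<-cmp (index (Crossing.u c)) (index (Crossing.w c))
  ... | tri< u<w _ _ = canonical-listed c (record { u<v = u<v ; w<z = w<z ; u<w = u<w })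
  ... | tri≈ _ u≡w _ = ⊥-elim (index-distinctˡ c (Fin.toℕ-injective u≡w))
  ... | tri> _ _ w<u = Listed-resp {c} {exchange c} (exchange-≈ c)
    (canonical-listed (exchange c) (record { u<v = w<z ; w<z = u<v ; u<w = w<u }))

  first-increasing-listed : ∀ (c : X) → index (Crossing.u c) ℕ.< index (Crossing.v c) → Listed c
  first-increasing-listed c u<v with ℕ.<-cmp (index (Crossing.w c)) (index (Crossing.z c))
  ... | tri< w<z _ _ = both-increasing-listed c u<v w<z
  ... | tri≈ _ w≡z _ = ⊥-elim (proj₁ (Crossing.w~z c) (Fin.toℕ-injective w≡z))
  ... | tri> _ _ z<w = Listed-resp {c} {reverseʳ c} (reverseʳ-≈ c) (both-increasing-listed (reverseʳ c) u<v z<w)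

  listed : ∀ c → Listed c
  listed c with ℕ.<-cmp (index (Crossing.u c)) (index (Crossing.v c))
  ... | tri< u<v _ _ = first-increasing-listed c u<v
  ... | tri≈ _ u≡v _ = ⊥-elim (proj₁ (Crossing.u~v c) (Fin.toℕ-injective u≡v))
  ... | tri> _ _ v<u = Listed-resp {c} {reverseˡ c} (reverseˡ-≈ c) (first-increasing-listed (reverseˡ c) v<u)

  finitely-many-crossings : ∃[ k ] HasCrossings ℝ drawing k × k ℕ.≤ length codes
  finitely-many-crossings =
    let k , bijection , k≤ = exhausted⇒finite X-decSetoid crossings (Listed.position ∘ listed) in
    k , bijection , ℕ.≤-trans k≤ length-crossings

  open Counting using (crossingQuadruples; 2*crossingQuadruples; bound)

  length-family : ∀ o → length (family o) ≡ crossingQuadruples n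
  length-family o = ≡.trans (List.length-++ (map (separate o) (quadruples separated n)))
    (≡.cong₂ ℕ._+_ (List.length-map (separate o) (quadruples separated n))
      (≡.trans (List.length-++ (map (interleave o) (quadruples alternating n)))
        (≡.cong₂ ℕ._+_ (List.length-map (interleave o) (quadruples alternating n))
          (List.length-map (nest o) (quadruples nested n)))))

  length-codes : length codes ≡ bound n
  length-codes = ≡.trans (List.length-++ (family false))
    (≡.trans (≡.cong₂ ℕ._+_ (length-family false) (≡.trans (length-family true) (≡.sym (ℕ.+-identityʳ _))))
      (2*crossingQuadruples n))

  cr≤bound : cr≤ ℝ G (bound n)
  cr≤bound = let k , bijection , k≤ = finitely-many-crossings in
    drawing , k , bijection , ℕ.≤-trans k≤ (ℕ.≤-reflexive length-codes)

open import Data.Nat.Base using (ℕ; _≤_; _*_; _∸_; ⌊_/2⌋)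

corollary2p1 : (ℝ : CompleteOrderedField) → ∀ (n : ℕ) → 1 ≤ n →
    cr≤ ℝ (K n ×ᴷ P 2) (⌊ n /2⌋ * ⌊ n ∸ 1 /2⌋ * ⌊ n ∸ 2 /2⌋ * ⌊ n ∸ 3 /2⌋)
corollary2p1 ℝ (suc m) _ = CrownCrossings.cr≤bound ℝ m
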